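{- Let $G$ be a balanced signed block graph with $n$ vertices all of whose edges have weight $1$, with blocks $B_1,\dots,B_k$, and let $A$ be its adjacency matrix. Then $$\mathrm{per}(A)=\sum\prod_{i=1}^k \alpha_i!\sum_{j=0}^{\alpha_i}\frac{(-1)^j}{j!},$$ where the outer sum is over all $k$-tuples $(\alpha_1,\dots,\alpha_k)$ of nonnegative integers such that (1) $\sum_{i=1}^k\alpha_i=n$, and (2) for every nonempty $S\subseteq\{1,\dots,k\}$, $\sum_{i\in S}\alpha_i\le|V(G_S)|$, where $G_S$ is the subgraph of $G$ induced by the blocks $B_i$, $i\in S$.
   Context: A signed graph is a simple undirected graph with edge weights in $\{1,-1\}$; its adjacency matrix has $(i,j)$ entry equal to the weight of edge $\{i,j\}$ and $0$ otherwise. It is balanced if every cycle has positive product of edge weights. A block is a maximal connected subgraph without a cut-vertex; a signed block graph is a signed graph each of whose blocks is a (signed) complete graph. $\mathrm{per}$ denotes the permanent. -}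

module Defs where

open import Data.Nat as ℕ using (ℕ; zero; suc; _≤_; _!)
open import Data.Nat.Properties using (_!≢0; _≤?_)
import Data.Nat.Properties as ℕP
open import Data.Integer as ℤ using (ℤ; +_; -_)
open import Data.Rational as ℚ using (ℚ; 0ℚ; 1ℚ)
open import Data.Fin as Fin using (Fin; toℕ)
open import Data.Fin.Properties using (all?; _≟_)
open import Data.Fin.Subset using (Subset; _∈_; _∉_; _⊆_; Nonempty; ⋃; ∣_∣; ⁅_⁆; _─_)
open import Data.Fin.Subset.Properties using (_∈?_; nonempty?)
import Data.Fin.Subset.Properties as SubP
open import Data.List as List using (List; map; concatMap; filter; foldr; allFin)
open import Data.Nat.ListAction using () renaming (sum to ℕsum)
open import Data.Vec.Functional using () renaming (_∷_ to _∷ᶠ_)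
open import Data.Product using (_×_; _,_; ∃; Σ)
open import Data.Sum using (_⊎_)
import Data.Bool as Bool
open import Data.Vec using ([]; _∷_)
open import Relation.Nullary using (Dec; yes; no; ¬_)
open import Relation.Nullary.Decidable using (_×-dec_; _→-dec_; ¬?)
open import Relation.Binary.PropositionalEquality using (_≡_; _≢_)

Σℚ : ∀ {m} → (Fin m → ℚ) → ℚ
Σℚ {m} f = foldr (λ i acc → f i ℚ.+ acc) 0ℚ (allFin m)

Πℚ : ∀ {m} → (Fin m → ℚ) → ℚ
Πℚ {m} f = foldr (λ i acc → f i ℚ.* acc) 1ℚ (allFin m)

Πℤ : ∀ {m} → (Fin m → ℤ) → ℤ
Πℤ {m} f = foldr (λ i acc → f i ℤ.* acc) (+ 1) (allFin m)

sumℚ : List ℚ → ℚ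
sumℚ = foldr ℚ._+_ 0ℚ

sumℤ : List ℤ → ℤ
sumℤ = foldr ℤ._+_ (+ 0)

ΣOver : ∀ {k} → Subset k → (Fin k → ℕ) → ℕ
ΣOver {k} S α = ℕsum (map α (filter (_∈? S) (allFin k)))

Σℕ : ∀ {k} → (Fin k → ℕ) → ℕ
Σℕ {k} α = ℕsum (map α (allFin k))

allFuns : (k m : ℕ) → List (Fin k → Fin m)
allFuns zero    m = (λ ()) List.∷ List.[]
allFuns (suc k) m =
  concatMap (λ (x : Fin m) → map (λ f → x ∷ᶠ f) (allFuns k m)) (allFin m)

-- Permanent of an n×n integer matrix:
--   per(A) = Σ_{σ ∈ S_n} ∏_i A i (σ i),
-- where S_n is realised as the injective maps Fin n → Fin n.

IsInjective : ∀ {n} → (Fin n → Fin n) → Set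
IsInjective σ = ∀ i j → σ i ≡ σ j → i ≡ j

isInjective? : ∀ {n} (σ : Fin n → Fin n) → Dec (IsInjective σ)
isInjective? σ = all? (λ i → all? (λ j → (σ i ≟ σ j) →-dec (i ≟ j)))

per : ∀ {n} → (Fin n → Fin n → ℤ) → ℤ
per {n} A = sumℤ (map (λ σ → Πℤ (λ i → A i (σ i)))
                      (filter isInjective? (allFuns n n)))

-- Signed graphs on vertex set Fin n, given by their adjacency matrix:
-- w i j = weight of edge {i,j} ∈ {1,-1}, and 0 if there is no edge.

-1ℤ : ℤ
-1ℤ = - (+ 1)

record SignedGraph (n : ℕ) : Set where
  field
    w        : Fin n → Fin n → ℤ
    w-values : ∀ i j → (w i j ≡ + 1) ⊎ (w i j ≡ -1ℤ) ⊎ (w i j ≡ + 0)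
    w-sym    : ∀ i j → w i j ≡ w j i
    w-diag   : ∀ i → w i i ≡ + 0

open SignedGraph public

adjMatrix : ∀ {n} → SignedGraph n → Fin n → Fin n → ℤ
adjMatrix G = w G

Adj : ∀ {n} → SignedGraph n → Fin n → Fin n → Set
Adj G i j = w G i j ≢ + 0

AllEdgesPositive : ∀ {n} → SignedGraph n → Set
AllEdgesPositive G = ∀ i j → Adj G i j → w G i j ≡ + 1

next : ∀ {m} → Fin m → Fin m
next {suc m} i with toℕ i ℕ.<? m
... | yes i<m = Fin.suc (Fin.fromℕ< i<m)
... | no  _   = Fin.zero

record Cycle {n} (G : SignedGraph n) (m : ℕ) : Set where
  field
    len≥3 : 3 ≤ m
    c     : Fin m → Fin n
    c-inj : ∀ i j → c i ≡ c j → i ≡ j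
    c-adj : ∀ i → Adj G (c i) (c (next i))

cycleSign : ∀ {n} {G : SignedGraph n} {m} → Cycle G m → ℤ
cycleSign {G = G} C = Πℤ (λ i → w G (Cycle.c C i) (Cycle.c C (next i)))

Balanced : ∀ {n} → SignedGraph n → Set
Balanced G = ∀ m (C : Cycle G m) → cycleSign C ≡ + 1

-- Blocks (vertex sets). A block is a maximal connected subgraph without a
-- cut-vertex; such a maximal subgraph is induced on its vertex set, so
-- we describe blocks by their vertex sets.

data Reach {n} (G : SignedGraph n) (T : Subset n) (x : Fin n) : Fin n → Set where
  here : x ∈ T → Reach G T x x
  step : ∀ {y z} → Reach G T x y → Adj G y z → z ∈ T → Reach G T x z

-- the induced subgraph G[T] is connected (vacuously so if T is empty)
ConnectedOn : ∀ {n} → SignedGraph n → Subset n → Set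
ConnectedOn G T = ∀ x y → x ∈ T → y ∈ T → Reach G T x y

NonSeparable : ∀ {n} → SignedGraph n → Subset n → Set
NonSeparable G T =
  Nonempty T × ConnectedOn G T × (∀ v → v ∈ T → ConnectedOn G (T ─ ⁅ v ⁆))

IsBlock : ∀ {n} → SignedGraph n → Subset n → Set
IsBlock G T = NonSeparable G T × (∀ U → T ⊆ U → NonSeparable G U → U ⊆ T)

IsBlockGraph : ∀ {n} → SignedGraph n → Set
IsBlockGraph G = ∀ T → IsBlock G T → ∀ x y → x ∈ T → y ∈ T → x ≢ y → Adj G x y

AreTheBlocks : ∀ {n k} → SignedGraph n → (Fin k → Subset n) → Set
AreTheBlocks G B =
  (∀ i → IsBlock G (B i)) ×
  (∀ i j → B i ≡ B j → i ≡ j) ×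
  (∀ T → IsBlock G T → ∃ λ i → B i ≡ T)

VS : ∀ {n k} → (Fin k → Subset n) → Subset k → Subset n
VS {k = k} B S = ⋃ (map B (filter (_∈? S) (allFin k)))

allSubsets? : ∀ {k} {P : Subset k → Set} → (∀ S → Dec (P S)) → Dec (∀ S → P S)
allSubsets? {zero} P? with P? []
... | yes p = yes (λ { [] → p })
... | no ¬p = no (λ f → ¬p (f []))
allSubsets? {suc k} {P} P? with allSubsets? {k} (λ S → P? (Bool.true ∷ S))
                              | allSubsets? {k} (λ S → P? (Bool.false ∷ S))
... | yes t | yes f = yes (λ { (Bool.true ∷ S) → t S ; (Bool.false ∷ S) → f S })
... | no ¬t | _     = no (λ g → ¬t (λ S → g (Bool.true ∷ S)))
... | yes _ | no ¬f = no (λ g → ¬f (λ S → g (Bool.false ∷ S)))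

Admissible : ∀ {n k} → (Fin k → Subset n) → (Fin k → ℕ) → Set
Admissible {n} B α =
  (Σℕ α ≡ n) × (∀ (S : Subset _) → Nonempty S → ΣOver S α ≤ ∣ VS B S ∣)

admissible? : ∀ {n k} (B : Fin k → Subset n) (α : Fin k → ℕ) → Dec (Admissible B α)
admissible? {n} B α =
  (Σℕ α ℕP.≟ n) ×-dec
  allSubsets? (λ S → nonempty? S →-dec (ΣOver S α ≤? ∣ VS B S ∣))

derTerm : ℕ → ℚ
derTerm a =
  ((+ (a !)) ℚ./ 1) ℚ.*
  Σℚ {suc a} (λ j → ((-1ℤ ℤ.^ toℕ j) ℚ./ (toℕ j !)) {{toℕ j !≢0}})

-- Σ over admissible (α_1,…,α_k) of ∏_i α_i! Σ_{j=0}^{α_i} (-1)^j/j!.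
-- Admissible tuples satisfy α_i ≤ n, so they are enumerated among all
-- maps Fin k → Fin (n+1).
blockFormula : ∀ {n k} → (Fin k → Subset n) → ℚ
blockFormula {n} {k} B =
  sumℚ (map (λ α → Πℚ (λ i → derTerm (α i)))
            (filter (admissible? B)
                    (map (λ f i → toℕ (f i)) (allFuns k (suc n)))))

{-# OPTIONS --safe #-}
module Submission where

-- The permanent counts the permutations σ with v adjacent to σ v for every v. Every cycle of such
-- a σ stays in one block: the union of the blocks met by a closed walk is nonseparable, so by
-- maximality these blocks coincide. Hence σ amounts to an assignment f of each vertex to a block
-- containing it, together with a derangement of every fibre of f, and the permanent is the sum
-- over f of the product of the derangement numbers of the fibre sizes. Two assignments with equal
-- fibre sizes agree, since following one and then the other where they differ would give a closed
-- walk through distinct blocks. By Hall's augmentation argument, the fibre sizes that occur are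
-- exactly the admissible tuples.

open import Defs
open import Data.Bool using (Bool; true; false; if_then_else_; _∧_; not)
import Data.Bool.Properties as BoolP
open import Data.Nat as ℕ using (ℕ; zero; suc; _≤_; _<_; z≤n; s≤s; _∸_; _!)
import Data.Nat.Properties as ℕP
open import Data.Nat.ListAction using () renaming (sum to ℕsum)
open import Data.Integer as ℤ using (ℤ; +_; _+_; _*_; _-_; 0ℤ; 1ℤ)
import Data.Integer.Properties as ℤP
open import Data.Integer.Tactic.RingSolver using (solve-∀)
open import Data.Rational as ℚ using (ℚ; 0ℚ; 1ℚ; _/_; toℚᵘ; fromℚᵘ)
import Data.Rational.Properties as ℚP
open import Data.Rational.Unnormalised as ℚᵘ using (mkℚᵘ; *≡*)
import Data.Rational.Unnormalised.Properties as ℚᵘP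
open import Data.Fin as Fin using (Fin; toℕ; fromℕ<)
import Data.Fin.Properties as FinP
open import Data.Fin.Subset using (Subset; _∈_; _∉_; _⊆_; ∣_∣; ⁅_⁆; _─_; _∪_; ⋃; Nonempty; inside; outside)
import Data.Fin.Subset.Properties as SubP
open import Data.Vec using ([]; _∷_; tabulate; here; there)
import Data.Vec.Properties as VecP
open import Data.Vec.Functional as Vector using (updateAt) renaming (_∷_ to _∷ᶠ_)
open import Data.Vec.Functional.Properties using (updateAt-updates; updateAt-minimal)
open import Data.List as List using (List; map; filter; foldr; allFin; concatMap; _++_)
import Data.List.Properties as ListP
open import Data.List.Relation.Unary.Any using (here; there)
open import Data.List.Membership.Propositional using () renaming (_∈_ to _∈ᴸ_)
import Data.List.Membership.Propositional.Properties as MemP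
open import Data.Product using (_×_; _,_; ∃-syntax; proj₁; proj₂)
open import Data.Sum using (_⊎_; inj₁; inj₂)
open import Function using (_∘_; id; const)
open import Relation.Nullary using (Dec; yes; no; ¬_; does; contradiction)
open import Relation.Nullary.Decidable using (decidable-stable; dec-true; dec-false; _×-dec_; ¬?)
open import Relation.Binary.PropositionalEquality
open import Algebra.Properties.Semiring.Sum ℕP.+-*-semiring using ()
  renaming (sum to sumℕ; sum-cong-≗ to sumℕ-cong; ∑-comm to sumℕ-comm; *-distribˡ-sum to *-sumℕ;
            sum-replicate-zero to sumℕ-zeros)
open import Algebra.Properties.Semiring.Sum ℤP.+-*-semiring using (∑-comm)
  renaming (sum to ∑; sum-cong-≗ to ∑-cong; ∑-distrib-+ to ∑-+; *-distribˡ-sum to *-∑;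
            sum-replicate-zero to ∑-zeros)
open import Algebra.Properties.CommutativeMonoid.Sum ℤP.*-1-commutativeMonoid using ()
  renaming (sum to ∏; sum-cong-≗ to ∏-cong)
open import Algebra.Properties.CommutativeMonoid.Sum ℚP.+-0-commutativeMonoid using ()
  renaming (sum to sumℚF; sum-cong-≗ to sumℚF-cong; sum-init-last to sumℚF-init-last)

-- Subsets and reachability

-- Blocks are accessible only through maximality, so their incidence structure is drawn from one
-- statement about closed walks, used three times: two blocks share at most one vertex, the cycles
-- of a permutation stay in one block, and assignments with equal fibre sizes agree. A walk is the
-- sequence of iterates of a map on the vertices, with a block index attached to each vertex; it may
-- revisit vertices, so no simple cycle has to be extracted. The fibres of an assignment are not
-- reindexed before being counted. All of them are deranged at once by the permanent of a matrix,
-- expanded along a row. Removing a vertex from a 2-cycle leaves a fixed point, so the induction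
-- must count permutations in which only some points are barred from being fixed. Lifting the bar
-- from one point and subtracting the permutations that fix it gives the recursion defining `D`.

⟪_⟫ : ∀ {n} {P : Fin n → Set} → (∀ x → Dec (P x)) → Subset n
⟪ P? ⟫ = tabulate (does ∘ P?)

∈⟪⟫⁺ : ∀ {n} {P : Fin n → Set} (P? : ∀ x → Dec (P x)) {x} → P x → x ∈ ⟪ P? ⟫
∈⟪⟫⁺ P? {x} px =
  VecP.lookup⇒[]= x _ (trans (VecP.lookup∘tabulate (does ∘ P?) x) (dec-true (P? x) px))

∈⟪⟫⁻ : ∀ {n} {P : Fin n → Set} (P? : ∀ x → Dec (P x)) {x} → x ∈ ⟪ P? ⟫ → P x
∈⟪⟫⁻ P? {x} x∈ with P? x | trans (sym (VecP.lookup∘tabulate (does ∘ P?) x)) (VecP.[]=⇒lookup x∈)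
... | yes px | _ = px
... | no  _  | ()

x∈p─q⇒x∉q : ∀ {n} {p q : Subset n} {x} → x ∈ p ─ q → x ∉ q
x∈p─q⇒x∉q {p = _ ∷ p} {q = _ ∷ q} (there x∈) (there x∈q) = x∈p─q⇒x∉q {p = p} {q} x∈ x∈q
x∈p─q⇒x∉q {p = _ ∷ _} {q = inside ∷ _} () here

x∈p─⁅y⁆⇒x≢y : ∀ {n} {p : Subset n} {x y} → x ∈ p ─ ⁅ y ⁆ → x ≢ y
x∈p─⁅y⁆⇒x≢y {p = p} {x} {y} x∈ = SubP.x∉⁅y⁆⇒x≢y (x∈p─q⇒x∉q {p = p} x∈)

x∈p─⁅y⁆ : ∀ {n} {p : Subset n} {x y} → x ∈ p → x ≢ y → x ∈ p ─ ⁅ y ⁆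
x∈p─⁅y⁆ x∈p x≢y = SubP.x∈p∧x∉q⇒x∈p─q x∈p (SubP.x≢y⇒x∉⁅y⁆ x≢y)

module _ {n} (G : SignedGraph n) where

  Adj-sym : ∀ {x y} → Adj G x y → Adj G y x
  Adj-sym {x} {y} a e = a (trans (w-sym G x y) e)

  Adj-irrefl : ∀ {x y} → Adj G x y → x ≢ y
  Adj-irrefl {x} a refl = a (w-diag G x)

  Reach-mono : ∀ {T T′ x y} → T ⊆ T′ → Reach G T x y → Reach G T′ x y
  Reach-mono s (here x∈)     = here (s x∈)
  Reach-mono s (step r a z∈) = step (Reach-mono s r) a (s z∈)

  Reach-trans : ∀ {T x y z} → Reach G T x y → Reach G T y z → Reach G T x z
  Reach-trans r (here _)      = r
  Reach-trans r (step s a z∈) = step (Reach-trans r s) a z∈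

  Reach-target : ∀ {T x y} → Reach G T x y → y ∈ T
  Reach-target (here x∈)    = x∈
  Reach-target (step _ _ z∈) = z∈

  Reach-sym : ∀ {T x y} → Reach G T x y → Reach G T y x
  Reach-sym (here x∈)     = here x∈
  Reach-sym (step r a z∈) =
    Reach-trans (step (here z∈) (Adj-sym a) (Reach-target r)) (Reach-sym r)

  connectedVia : ∀ {T} z → (∀ y → y ∈ T → Reach G T z y) → ConnectedOn G T
  connectedVia z r x y x∈ y∈ = Reach-trans (Reach-sym (r x x∈)) (r y y∈)

  -- Covering `v` outside `T` as well allows one vertex to be deleted from all blocks along a walk,
  -- whether or not they contain it.
  connected-─ : ∀ {T} → NonSeparable G T → ∀ v → ConnectedOn G (T ─ ⁅ v ⁆)
  connected-─ {T} (_ , c , cut) v with v SubP.∈? T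
  ... | yes v∈ = cut v v∈
  ... | no  v∉ = λ x y x∈ y∈ →
    Reach-mono (λ {z} z∈ → x∈p─⁅y⁆ z∈ (λ z≡v → v∉ (subst (_∈ T) z≡v z∈)))
      (c x y (SubP.p─q⊆p T _ x∈) (SubP.p─q⊆p T _ y∈))

  clique-connected : ∀ {T} → (∀ x y → x ∈ T → y ∈ T → x ≢ y → Adj G x y) → ConnectedOn G T
  clique-connected adj x y x∈ y∈ with x FinP.≟ y
  ... | yes refl = here x∈
  ... | no x≢y   = step (here x∈) (adj x y x∈ y∈ x≢y) y∈

  -- Deleting a vertex from a clique leaves a clique. Applied to single vertices and single edges,
  -- to place them in blocks.
  clique-nonseparable : ∀ {T} → Nonempty T →
    (∀ x y → x ∈ T → y ∈ T → x ≢ y → Adj G x y) → NonSeparable G T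
  clique-nonseparable {T} ne adj = ne , clique-connected adj , λ v _ →
    clique-connected (λ x y x∈ y∈ → adj x y (SubP.p─q⊆p T _ x∈) (SubP.p─q⊆p T _ y∈))

-- Orbits of self-maps

iter : ∀ {A : Set} → (A → A) → ℕ → A → A
iter h zero    x = x
iter h (suc i) x = h (iter h i x)

module _ {A : Set} (h : A → A) where

  iter-+ : ∀ i j x → iter h (i ℕ.+ j) x ≡ iter h i (iter h j x)
  iter-+ zero    j x = refl
  iter-+ (suc i) j x = cong h (iter-+ i j x)

  iter-shift : ∀ i x → iter h i (h x) ≡ iter h (suc i) x
  iter-shift zero    x = refl
  iter-shift (suc i) x = cong h (iter-shift i x)

  iter-* : ∀ c {m x} → iter h m x ≡ x → iter h (c ℕ.* m) x ≡ x
  iter-* zero            e = refl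
  iter-* (suc c) {m} {x} e =
    trans (iter-+ m (c ℕ.* m) x) (trans (cong (iter h m) (iter-* c e)) e)

  -- Adding `j` full periods to `i` leaves the point unchanged and makes the exponent at least `j`,
  -- the period being positive.
  iter-rebase : ∀ {m x} → iter h (suc m) x ≡ x → ∀ i j →
    ∃[ l ] iter h i x ≡ iter h l (iter h j x)
  iter-rebase {m} {x} e i j = i ℕ.+ (j ℕ.* suc m ∸ j) , (begin
    iter h i x                                        ≡⟨ cong (iter h i) (iter-* j e) ⟨
    iter h i (iter h (j ℕ.* suc m) x)                 ≡⟨ iter-+ i _ x ⟨
    iter h (i ℕ.+ j ℕ.* suc m) x                      ≡⟨ cong (λ t → iter h (i ℕ.+ t) x)
                                                          (ℕP.m∸n+n≡m (ℕP.m≤m*n j (suc m))) ⟨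
    iter h (i ℕ.+ (j ℕ.* suc m ∸ j ℕ.+ j)) x          ≡⟨ cong (λ t → iter h t x) (ℕP.+-assoc i _ j) ⟨
    iter h (i ℕ.+ (j ℕ.* suc m ∸ j) ℕ.+ j) x          ≡⟨ iter-+ (i ℕ.+ (j ℕ.* suc m ∸ j)) j x ⟩
    iter h (i ℕ.+ (j ℕ.* suc m ∸ j)) (iter h j x)     ∎)
    where open ≡-Reasoning

-- The step count restarts at zero whenever the walk comes back to `x`; what remains is the stretch
-- after the last visit.
iter-nonreturning : ∀ {n} (h : Fin n → Fin n) x i →
  ∃[ l ] iter h i x ≡ iter h l x × (∀ t → suc t ≤ l → iter h (suc t) x ≢ x)
iter-nonreturning h x zero = 0 , refl , λ _ ()
iter-nonreturning h x (suc i) with iter-nonreturning h x i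
... | l , e , nr with iter h (suc l) x FinP.≟ x
...   | yes back = 0 , trans (cong h e) back , λ _ ()
...   | no  ¬back = suc l , cong h e , nr′
  where
  nr′ : ∀ t → suc t ≤ suc l → iter h (suc t) x ≢ x
  nr′ t (s≤s t≤l) with ℕP.m≤n⇒m<n∨m≡n t≤l
  ... | inj₁ t<l  = nr t t<l
  ... | inj₂ refl = ¬back

-- Without injectivity the orbit may have a tail before its cycle, so periodicity is claimed only
-- for some later point.
orbit-periodic : ∀ {n} (h : Fin n → Fin n) x →
  ∃[ i ] ∃[ m ] iter h (suc m) (iter h i x) ≡ iter h i x
orbit-periodic {n} h x with FinP.pigeonhole (ℕP.n<1+n n) (λ i → iter h (toℕ i) x)
... | i , j , i<j , e = toℕ i , toℕ j ∸ suc (toℕ i) , (begin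
  iter h (suc (toℕ j ∸ suc (toℕ i))) (iter h (toℕ i) x) ≡⟨ iter-+ h (suc (toℕ j ∸ suc (toℕ i))) (toℕ i) x ⟨
  iter h (suc (toℕ j ∸ suc (toℕ i) ℕ.+ toℕ i)) x        ≡⟨ cong (λ t → iter h t x)
                                                            (trans (sym (ℕP.+-suc _ (toℕ i))) (ℕP.m∸n+n≡m i<j)) ⟩
  iter h (toℕ j) x                                      ≡⟨ e ⟨
  iter h (toℕ i) x                                      ∎)
  where open ≡-Reasoning

iter-injective : ∀ {n} (h : Fin n → Fin n) → IsInjective h → ∀ i {x y} → iter h i x ≡ iter h i y → x ≡ y
iter-injective h inj zero    e = e
iter-injective h inj (suc i) e = iter-injective h inj i (inj _ _ e)

injective-periodic : ∀ {n} (h : Fin n → Fin n) → IsInjective h → ∀ x → ∃[ m ] iter h (suc m) x ≡ x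
injective-periodic h inj x with orbit-periodic h x
... | i , m , e = m , iter-injective h inj i (begin
  iter h i (iter h (suc m) x)  ≡⟨ iter-+ h i (suc m) x ⟨
  iter h (i ℕ.+ suc m) x       ≡⟨ cong (λ t → iter h t x) (ℕP.+-comm i (suc m)) ⟩
  iter h (suc m ℕ.+ i) x       ≡⟨ iter-+ h (suc m) i x ⟩
  iter h (suc m) (iter h i x)  ≡⟨ e ⟩
  iter h i x                   ∎)
  where open ≡-Reasoning

-- Closed walks and blocks

module Blocks {n} (G : SignedGraph n) {k} (B : Fin k → Subset n) (blocks : AreTheBlocks G B) where

  isBlock : ∀ i → IsBlock G (B i)
  isBlock = proj₁ blocks

  -- If `T` were in no block, it would be maximal: a strictly larger nonseparable `U` lies in a
  -- block by induction on the number of missing vertices, and `T` with it. But then `T` is itself a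
  -- block. The argument by contradiction is constructive because containment in one of finitely
  -- many blocks is decidable, so maximality never has to be decided.
  ⊆-some-block : ∀ T → NonSeparable G T → ∃[ i ] T ⊆ B i
  ⊆-some-block T = go (n ∸ ∣ T ∣) T ℕP.≤-refl
    where
    in-block? : ∀ T → Dec (∃[ i ] T ⊆ B i)
    in-block? T = FinP.any? (λ i → T SubP.⊆? B i)

    go : ∀ d T → n ∸ ∣ T ∣ ≤ d → NonSeparable G T → ∃[ i ] T ⊆ B i
    extend : ∀ d T → n ∸ ∣ T ∣ ≤ d → ∀ U → T ⊆ U → NonSeparable G U →
      ∀ {x} → x ∈ U → x ∉ T → ∃[ i ] T ⊆ B i
    go d T le ns = decidable-stable (in-block? T) λ none →
      let T-block : IsBlock G T
          T-block = ns , λ U T⊆U nsU {x} x∈U → decidable-stable (x SubP.∈? T)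
                           (λ x∉T → none (extend d T le U T⊆U nsU x∈U x∉T))
          i , Bi≡T = proj₂ (proj₂ blocks) T T-block
      in none (i , λ {x} → subst (x ∈_) (sym Bi≡T))
    extend zero T le U T⊆U nsU {x} x∈U x∉T =
      contradiction (ℕP.<-≤-trans (SubP.p⊂q⇒∣p∣<∣q∣ {p = T} {U} (T⊆U , x , x∈U , x∉T)) (SubP.∣p∣≤n U))
        (ℕP.≤⇒≯ (ℕP.m∸n≡0⇒m≤n (ℕP.n≤0⇒n≡0 le)))
    extend (suc d) T le U T⊆U nsU {x} x∈U x∉T =
      let T<U = SubP.p⊂q⇒∣p∣<∣q∣ {p = T} {U} (T⊆U , x , x∈U , x∉T)
          i , U⊆ = go d U (ℕP.≤-pred (ℕP.<-≤-trans (ℕP.∸-monoʳ-< T<U (SubP.∣p∣≤n U)) le)) nsU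
      in i , λ t∈ → U⊆ (T⊆U t∈)

  vertex-in-block : ∀ v → ∃[ i ] v ∈ B i
  vertex-in-block v =
    let i , ⊆B = ⊆-some-block ⁅ v ⁆ (clique-nonseparable G (v , SubP.x∈⁅x⁆ v) λ x y x∈ y∈ x≢y →
                   contradiction (trans (SubP.x∈⁅y⁆⇒x≡y v x∈) (sym (SubP.x∈⁅y⁆⇒x≡y v y∈))) x≢y)
    in i , ⊆B (SubP.x∈⁅x⁆ v)

  edge-in-block : ∀ {u v} → Adj G u v → ∃[ i ] u ∈ B i × v ∈ B i
  edge-in-block {u} {v} adj =
    let i , ⊆B = ⊆-some-block T (clique-nonseparable G (u , u∈) edge)
    in i , ⊆B u∈ , ⊆B v∈
    where
    T = ⁅ u ⁆ ∪ ⁅ v ⁆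
    u∈ : u ∈ T
    u∈ = SubP.x∈p∪q⁺ (inj₁ (SubP.x∈⁅x⁆ u))
    v∈ : v ∈ T
    v∈ = SubP.x∈p∪q⁺ {p = ⁅ u ⁆} (inj₂ (SubP.x∈⁅x⁆ v))
    split : ∀ {x} → x ∈ T → x ≡ u ⊎ x ≡ v
    split {x} x∈ with SubP.x∈p∪q⁻ ⁅ u ⁆ ⁅ v ⁆ x∈
    ... | inj₁ p = inj₁ (SubP.x∈⁅y⁆⇒x≡y u p)
    ... | inj₂ p = inj₂ (SubP.x∈⁅y⁆⇒x≡y v p)
    edge : ∀ x y → x ∈ T → y ∈ T → x ≢ y → Adj G x y
    edge x y x∈ y∈ x≢y with split x∈ | split y∈
    ... | inj₁ refl | inj₁ refl = contradiction refl x≢y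
    ... | inj₁ refl | inj₂ refl = adj
    ... | inj₂ refl | inj₁ refl = Adj-sym G adj
    ... | inj₂ refl | inj₂ refl = contradiction refl x≢y

  module _ (h : Fin n → Fin n) (β : Fin n → Fin k) where

    -- The sets at steps `t` and `suc t` share the vertex `iter h (suc t) z`, so paths inside them
    -- concatenate. `C` stands for the blocks or for the blocks with a vertex deleted; in the latter
    -- case membership may hold only up to the next visit to that vertex, hence the bounds on `t`.
    reach-along-chain : (C : Fin k → Subset n) → (∀ j → ConnectedOn G (C j)) →
      ∀ {T} z i → (∀ t → t ≤ i → C (β (iter h t z)) ⊆ T) →
      (∀ t → t ≤ i → iter h t z ∈ C (β (iter h t z))) →
      (∀ t → suc t ≤ i → iter h (suc t) z ∈ C (β (iter h t z))) →
      ∀ y → y ∈ C (β (iter h i z)) → Reach G T z y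
    reach-along-chain C conn z zero C⊆ own nxt y y∈ =
      Reach-mono G (C⊆ 0 z≤n) (conn _ z y (own 0 z≤n) y∈)
    reach-along-chain C conn z (suc i) C⊆ own nxt y y∈ = Reach-trans G
      (reach-along-chain C conn z i (λ t → C⊆ t ∘ ℕP.m≤n⇒m≤1+n) (λ t → own t ∘ ℕP.m≤n⇒m≤1+n)
        (λ t → nxt t ∘ ℕP.m≤n⇒m≤1+n) _ (nxt i ℕP.≤-refl))
      (Reach-mono G (C⊆ (suc i) ℕP.≤-refl) (conn _ _ y (own (suc i) ℕP.≤-refl) y∈))

    -- The union of the blocks along a closed walk stays connected after deleting any vertex x:
    -- if x lies on the walk, start from its successor and go round until x is met again.
    module _ (w₀ : Fin n) (m : ℕ) (closed : iter h (suc m) w₀ ≡ w₀)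
             (own   : ∀ i → iter h i w₀ ∈ B (β (iter h i w₀)))
             (nxt   : ∀ i → iter h (suc i) w₀ ∈ B (β (iter h i w₀)))
             (moves : ∀ i → iter h (suc i) w₀ ≢ iter h i w₀) where

      -- Reduction of the step number modulo the period, which lets `U` range over finitely many
      -- steps and keeps membership decidable.
      reduce : ∀ i → ∃[ j ] iter h i w₀ ≡ iter h (toℕ {suc m} j) w₀
      reduce zero = Fin.zero , refl
      reduce (suc i) with reduce i
      ... | j , e with ℕP.m≤n⇒m<n∨m≡n (FinP.toℕ≤pred[n] j)
      ...   | inj₁ j<m = fromℕ< (s≤s j<m) ,
                         trans (cong h e) (cong (λ t → iter h t w₀) (sym (FinP.toℕ-fromℕ< (s≤s j<m))))
      ...   | inj₂ j≡m = Fin.zero , trans (cong h (trans e (cong (λ t → iter h t w₀) j≡m))) closed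

      on-walk? : ∀ y → Dec (∃[ j ] y ∈ B (β (iter h (toℕ {suc m} j) w₀)))
      on-walk? y = FinP.any? (λ j → y SubP.∈? B (β (iter h (toℕ j) w₀)))

      U : Subset n
      U = ⟪ on-walk? ⟫

      B⊆U : ∀ i → B (β (iter h i w₀)) ⊆ U
      B⊆U i {y} y∈ = let j , e = reduce i in
        ∈⟪⟫⁺ on-walk? (j , subst (λ z → y ∈ B (β z)) e y∈)

      U-connected : ConnectedOn G U
      U-connected = connectedVia G w₀ λ y y∈ →
        let j , y∈B = ∈⟪⟫⁻ on-walk? y∈ in
        reach-along-chain B (λ i → proj₁ (proj₂ (proj₁ (isBlock i)))) w₀ (toℕ j)
          (λ t _ → B⊆U t) (λ t _ → own t) (λ t _ → nxt t) y y∈B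

      module _ (x : Fin n) where

        C : Fin k → Subset n
        C i = B i ─ ⁅ x ⁆

        C-connected : ∀ i → ConnectedOn G (C i)
        C-connected i = connected-─ G (proj₁ (isBlock i)) x

        C⊆ : ∀ i → C (β (iter h i w₀)) ⊆ U ─ ⁅ x ⁆
        C⊆ i y∈ = x∈p─⁅y⁆ (B⊆U i (SubP.p─q⊆p (B _) _ y∈)) (x∈p─⁅y⁆⇒x≢y {p = B _} y∈)

        from-off-walk : (∀ i → iter h i w₀ ≢ x) → ConnectedOn G (U ─ ⁅ x ⁆)
        from-off-walk off = connectedVia G w₀ λ y y∈ →
          let j , y∈B = ∈⟪⟫⁻ on-walk? (SubP.p─q⊆p U _ y∈) in
          reach-along-chain C C-connected w₀ (toℕ j) (λ t _ → C⊆ t)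
            (λ t _ → x∈p─⁅y⁆ (own t) (off t)) (λ t _ → x∈p─⁅y⁆ (nxt t) (off (suc t)))
            y (x∈p─⁅y⁆ y∈B (x∈p─⁅y⁆⇒x≢y {p = U} y∈))

        from-on-walk : ∀ i → iter h i w₀ ≡ x → ConnectedOn G (U ─ ⁅ x ⁆)
        from-on-walk i refl = connectedVia G (h x) λ y y∈ →
          let j , y∈B = ∈⟪⟫⁻ on-walk? (SubP.p─q⊆p U _ y∈)
              -- The step whose block contains `y` is renumbered as a number of steps after `x`,
              -- then counted from the last visit to `x` before it.
              l , e   = iter-rebase h {m} closed (toℕ j) i
              l′ , e′ , nr = iter-nonreturning h x l
          in reach y l′ nr (x∈p─⁅y⁆ (subst (λ z → y ∈ B (β z)) (trans e e′) y∈B) (x∈p─⁅y⁆⇒x≢y {p = U} y∈))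
          where
          walk : ∀ t → iter h (t ℕ.+ i) w₀ ≡ iter h t x
          walk t = iter-+ h t i w₀
          own′ : ∀ t → iter h t x ∈ B (β (iter h t x))
          own′ t = subst (λ z → z ∈ B (β z)) (walk t) (own (t ℕ.+ i))
          nxt′ : ∀ t → iter h (suc t) x ∈ B (β (iter h t x))
          nxt′ t = subst (λ z → h z ∈ B (β z)) (walk t) (nxt (t ℕ.+ i))
          C⊆′ : ∀ t → C (β (iter h t x)) ⊆ U ─ ⁅ x ⁆
          C⊆′ t = subst (λ z → C (β z) ⊆ U ─ ⁅ x ⁆) (walk t) (C⊆ (t ℕ.+ i))
          reach : ∀ y l → (∀ t → suc t ≤ l → iter h (suc t) x ≢ x) →
            y ∈ C (β (iter h l x)) → Reach G (U ─ ⁅ x ⁆) (h x) y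
          -- Here `y` is in the block attached to `x` itself. That block also contains `h x`, which
          -- survives the deletion of `x` by `moves`.
          reach y zero nr y∈ = Reach-mono G (C⊆′ 0)
            (C-connected _ (h x) y (x∈p─⁅y⁆ (nxt′ 0) (moves i)) y∈)
          reach y (suc l) nr y∈ = reach-along-chain C C-connected (h x) l
            (λ t _ → subst (λ z → C (β z) ⊆ U ─ ⁅ x ⁆) (sym (iter-shift h t x)) (C⊆′ (suc t)))
            (λ t t≤l → subst (λ z → z ∈ C (β z)) (sym (iter-shift h t x))
               (x∈p─⁅y⁆ (own′ (suc t)) (nr t (s≤s t≤l))))
            (λ t t<l → subst (λ z → h z ∈ C (β z)) (sym (iter-shift h t x))
               (x∈p─⁅y⁆ (nxt′ (suc t)) (nr (suc t) (s≤s t<l))))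
            y (subst (λ z → y ∈ C (β z)) (sym (iter-shift h l x)) y∈)

      U-nonseparable : NonSeparable G U
      U-nonseparable = (w₀ , B⊆U 0 (own 0)) , U-connected , λ x _ → cut x
        where
        cut : ∀ x → ConnectedOn G (U ─ ⁅ x ⁆)
        cut x with FinP.any? {suc m} (λ j → iter h (toℕ j) w₀ FinP.≟ x)
        ... | yes (j , e) = from-on-walk x (toℕ j) e
        ... | no  none    = from-off-walk x λ i e →
          let j , e′ = reduce i in none (j , trans (sym e′) e)

      closed-walk-one-block : β (h w₀) ≡ β w₀
      closed-walk-one-block = proj₁ (proj₂ blocks) _ _ (trans (B≡U 1) (sym (B≡U 0)))
        where
        B≡U : ∀ i → B (β (iter h i w₀)) ≡ U
        B≡U i = SubP.⊆-antisym (B⊆U i) (proj₂ (isBlock _) U (B⊆U i) U-nonseparable)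

  -- The closed walk goes from `x` to `y` inside `B i` and back inside `B j`, so the two blocks
  -- coincide.
  two-points-one-block : ∀ {x y i j} → x ≢ y → x ∈ B i → y ∈ B i → x ∈ B j → y ∈ B j → i ≡ j
  two-points-one-block {x} {y} {i} {j} x≢y xi yi xj yj =
    trans (sym βx) (trans (sym (closed-walk-one-block h β x 1 hhx own nxt moves)) (trans (cong β hx) βy))
    where
    h : Fin n → Fin n
    h z with z FinP.≟ x
    ... | yes _ = y
    ... | no  _ = x
    β : Fin n → Fin k
    β z with z FinP.≟ x
    ... | yes _ = i
    ... | no  _ = j
    hx : h x ≡ y
    hx with x FinP.≟ x
    ... | yes _ = refl
    ... | no ¬p = contradiction refl ¬p
    hy : h y ≡ x
    hy with y FinP.≟ x
    ... | yes e = contradiction (sym e) x≢y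
    ... | no _  = refl
    βx : β x ≡ i
    βx with x FinP.≟ x
    ... | yes _ = refl
    ... | no ¬p = contradiction refl ¬p
    βy : β y ≡ j
    βy with y FinP.≟ x
    ... | yes e = contradiction (sym e) x≢y
    ... | no _  = refl
    hhx : h (h x) ≡ x
    hhx = trans (cong h hx) hy
    alternates : ∀ t → (iter h t x ≡ x) ⊎ (iter h t x ≡ y)
    alternates zero = inj₁ refl
    alternates (suc t) with alternates t
    ... | inj₁ e = inj₂ (trans (cong h e) hx)
    ... | inj₂ e = inj₁ (trans (cong h e) hy)
    own : ∀ t → iter h t x ∈ B (β (iter h t x))
    own t with iter h t x | alternates t
    ... | _ | inj₁ refl = subst (λ l → x ∈ B l) (sym βx) xi
    ... | _ | inj₂ refl = subst (λ l → y ∈ B l) (sym βy) yj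
    nxt : ∀ t → iter h (suc t) x ∈ B (β (iter h t x))
    nxt t with iter h t x | alternates t
    ... | _ | inj₁ refl = subst₂ (λ u l → u ∈ B l) (sym hx) (sym βx) yi
    ... | _ | inj₂ refl = subst₂ (λ u l → u ∈ B l) (sym hy) (sym βy) xj
    moves : ∀ t → iter h (suc t) x ≢ iter h t x
    moves t with iter h t x | alternates t
    ... | _ | inj₁ refl = λ e → x≢y (trans (sym e) hx)
    ... | _ | inj₂ refl = λ e → x≢y (trans (sym hy) e)

-- Fibre sizes of block assignments

ind : ∀ {P : Set} → Dec P → ℕ
ind d = if does d then 1 else 0

ind-yes : ∀ {P : Set} (d : Dec P) → P → ind d ≡ 1
ind-yes d p rewrite dec-true d p = refl

ind-no : ∀ {P : Set} (d : Dec P) → ¬ P → ind d ≡ 0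
ind-no d p rewrite dec-false d p = refl

ind-mono : ∀ {P Q : Set} (d : Dec P) (e : Dec Q) → (P → Q) → ind d ≤ ind e
ind-mono (yes p) e f rewrite ind-yes e (f p) = ℕP.≤-refl
ind-mono (no _)  e f = z≤n

ind-cong : ∀ {P Q : Set} (d : Dec P) (e : Dec Q) → (P → Q) → (Q → P) → ind d ≡ ind e
ind-cong d e f g = ℕP.≤-antisym (ind-mono d e f) (ind-mono e d g)

sum-mono : ∀ {n} {f g : Fin n → ℕ} → (∀ i → f i ≤ g i) → sumℕ f ≤ sumℕ g
sum-mono {zero}  le = z≤n
sum-mono {suc n} le = ℕP.+-mono-≤ (le Fin.zero) (sum-mono (le ∘ Fin.suc))

sum-mono-< : ∀ {n} {f g : Fin n → ℕ} → (∀ i → f i ≤ g i) → ∀ j → f j < g j → sumℕ f < sumℕ g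
sum-mono-< le Fin.zero    lt = ℕP.+-mono-<-≤ lt (sum-mono (le ∘ Fin.suc))
sum-mono-< le (Fin.suc j) lt = ℕP.+-mono-≤-< (le Fin.zero) (sum-mono-< (le ∘ Fin.suc) j lt)

-- Each sum is completed by the other function's value at `v`, which avoids truncated subtraction.
sum-exchange : ∀ {n} {s t : Fin n → ℕ} v → (∀ u → u ≢ v → s u ≡ t u) → sumℕ s ℕ.+ t v ≡ sumℕ t ℕ.+ s v
sum-exchange {suc n} {s} {t} Fin.zero eq = begin
  s₀ ℕ.+ sumℕ (s ∘ Fin.suc) ℕ.+ t₀ ≡⟨ cong (λ z → s₀ ℕ.+ z ℕ.+ t₀) (sumℕ-cong (λ i → eq (Fin.suc i) λ ())) ⟩
  s₀ ℕ.+ sumℕ (t ∘ Fin.suc) ℕ.+ t₀ ≡⟨ ℕP.+-assoc s₀ _ t₀ ⟩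
  s₀ ℕ.+ (sumℕ (t ∘ Fin.suc) ℕ.+ t₀) ≡⟨ ℕP.+-comm s₀ _ ⟩
  sumℕ (t ∘ Fin.suc) ℕ.+ t₀ ℕ.+ s₀ ≡⟨ cong (ℕ._+ s₀) (ℕP.+-comm _ t₀) ⟩
  t₀ ℕ.+ sumℕ (t ∘ Fin.suc) ℕ.+ s₀ ∎
  where
  open ≡-Reasoning
  s₀ = s Fin.zero
  t₀ = t Fin.zero
sum-exchange {suc n} {s} {t} (Fin.suc v) eq = begin
  s Fin.zero ℕ.+ sumℕ (s ∘ Fin.suc) ℕ.+ t (Fin.suc v) ≡⟨ ℕP.+-assoc (s Fin.zero) _ _ ⟩
  s Fin.zero ℕ.+ (sumℕ (s ∘ Fin.suc) ℕ.+ t (Fin.suc v))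
    ≡⟨ cong₂ ℕ._+_ (eq Fin.zero λ ()) (sum-exchange v λ u u≢v → eq (Fin.suc u) (u≢v ∘ FinP.suc-injective)) ⟩
  t Fin.zero ℕ.+ (sumℕ (t ∘ Fin.suc) ℕ.+ s (Fin.suc v)) ≡⟨ ℕP.+-assoc (t Fin.zero) _ _ ⟨
  t Fin.zero ℕ.+ sumℕ (t ∘ Fin.suc) ℕ.+ s (Fin.suc v) ∎
  where open ≡-Reasoning

sum-zero : ∀ {n} {f : Fin n → ℕ} → (∀ i → f i ≡ 0) → sumℕ f ≡ 0
sum-zero {n} eq = trans (sumℕ-cong eq) (sumℕ-zeros n)

sum-ind : ∀ {n} (i : Fin n) (c : Fin n → ℕ) → sumℕ (λ j → c j ℕ.* ind (i FinP.≟ j)) ≡ c i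
sum-ind {suc n} i@Fin.zero c = begin
  c i ℕ.* 1 ℕ.+ sumℕ (λ j → c (Fin.suc j) ℕ.* ind (i FinP.≟ Fin.suc j))
    ≡⟨ cong₂ ℕ._+_ (ℕP.*-identityʳ (c i)) (sum-zero λ j → ℕP.*-zeroʳ (c (Fin.suc j))) ⟩
  c i ℕ.+ 0 ≡⟨ ℕP.+-identityʳ (c i) ⟩
  c i ∎
  where open ≡-Reasoning
sum-ind {suc n} (Fin.suc i) c = begin
  c Fin.zero ℕ.* 0 ℕ.+ sumℕ (λ j → c (Fin.suc j) ℕ.* ind (Fin.suc i FinP.≟ Fin.suc j))
    ≡⟨ cong₂ ℕ._+_ (ℕP.*-zeroʳ (c Fin.zero)) (sumℕ-cong λ j → cong (c (Fin.suc j) ℕ.*_)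
         (ind-cong (Fin.suc i FinP.≟ Fin.suc j) (i FinP.≟ j) FinP.suc-injective (cong Fin.suc))) ⟩
  sumℕ (λ j → c (Fin.suc j) ℕ.* ind (i FinP.≟ j))
    ≡⟨ sum-ind i (c ∘ Fin.suc) ⟩
  c (Fin.suc i) ∎
  where open ≡-Reasoning

fibre : ∀ {n k} → (Fin n → Fin k) → Fin k → ℕ
fibre f i = sumℕ (λ v → ind (f v FinP.≟ i))

-- Double counting with a weight `c` on the blocks: constant 1 gives the total `n`, the indicator of
-- `S` gives the vertices assigned into `S`.
sum-fibre : ∀ {n k} (f : Fin n → Fin k) (c : Fin k → ℕ) → sumℕ (λ i → c i ℕ.* fibre f i) ≡ sumℕ (c ∘ f)
sum-fibre f c = begin
  sumℕ (λ i → c i ℕ.* fibre f i)                       ≡⟨ sumℕ-cong (λ i → *-sumℕ (c i) (λ v → ind (f v FinP.≟ i))) ⟩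
  sumℕ (λ i → sumℕ (λ v → c i ℕ.* ind (f v FinP.≟ i)))  ≡⟨ sumℕ-comm (λ i v → c i ℕ.* ind (f v FinP.≟ i)) ⟩
  sumℕ (λ v → sumℕ (λ i → c i ℕ.* ind (f v FinP.≟ i)))  ≡⟨ sumℕ-cong (λ v → sum-ind (f v) c) ⟩
  sumℕ (c ∘ f)                                       ∎
  where open ≡-Reasoning

sum-one : ∀ n → sumℕ {n} (const 1) ≡ n
sum-one zero    = refl
sum-one (suc n) = cong suc (sum-one n)

sum-fibre≡n : ∀ {n k} (f : Fin n → Fin k) → sumℕ (fibre f) ≡ n
sum-fibre≡n {n} f = begin
  sumℕ (fibre f)                 ≡⟨ sumℕ-cong (λ i → ℕP.*-identityˡ (fibre f i)) ⟨
  sumℕ (λ i → 1 ℕ.* fibre f i)     ≡⟨ sum-fibre f (const 1) ⟩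
  sumℕ {n} (const 1)             ≡⟨ sum-one n ⟩
  n                             ∎
  where open ≡-Reasoning

∣p∣≡sum : ∀ {n} (p : Subset n) → ∣ p ∣ ≡ sumℕ (λ v → ind (v SubP.∈? p))
∣p∣≡sum [] = refl
∣p∣≡sum (inside  ∷ p) = cong suc (trans (∣p∣≡sum p) (sumℕ-cong λ v →
  ind-cong (v SubP.∈? p) (Fin.suc v SubP.∈? (inside ∷ p)) there SubP.drop-there))
∣p∣≡sum (outside ∷ p) = trans (∣p∣≡sum p) (sumℕ-cong λ v →
  ind-cong (v SubP.∈? p) (Fin.suc v SubP.∈? (outside ∷ p)) there SubP.drop-there)

foldr-tabulate : ∀ {A B : Set} (c : A → B → B) (e : B) {n} (g : Fin n → A) →
  List.foldr c e (List.tabulate g) ≡ Vector.foldr (λ a b → c a b) e g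
foldr-tabulate c e {zero}  g = refl
foldr-tabulate c e {suc n} g = cong (c (g Fin.zero)) (foldr-tabulate c e (g ∘ Fin.suc))

Σℕ≡sum : ∀ {k} (α : Fin k → ℕ) → Σℕ α ≡ sumℕ α
Σℕ≡sum α = trans (cong ℕsum (ListP.map-tabulate id α)) (foldr-tabulate ℕ._+_ 0 α)

sum-filter : ∀ {A : Set} {P : A → Set} (P? : ∀ x → Dec (P x)) (α : A → ℕ) xs →
  ℕsum (map α (filter P? xs)) ≡ ℕsum (map (λ x → ind (P? x) ℕ.* α x) xs)
sum-filter P? α List.[] = refl
sum-filter P? α (x List.∷ xs) with P? x
... | yes _ = cong₂ ℕ._+_ (sym (ℕP.+-identityʳ (α x))) (sum-filter P? α xs)
... | no  _ = sum-filter P? α xs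

ΣOver≡sum : ∀ {k} (S : Subset k) (α : Fin k → ℕ) → ΣOver S α ≡ sumℕ (λ i → ind (i SubP.∈? S) ℕ.* α i)
ΣOver≡sum S α = trans (sum-filter (SubP._∈? S) α (allFin _)) (Σℕ≡sum (λ i → ind (i SubP.∈? S) ℕ.* α i))

∈⋃⁺ : ∀ {n} {x : Fin n} {p} {ps : List (Subset n)} → p ∈ᴸ ps → x ∈ p → x ∈ ⋃ ps
∈⋃⁺ (here refl) x∈ = SubP.x∈p∪q⁺ (inj₁ x∈)
∈⋃⁺ {ps = q List.∷ ps} (there p∈) x∈ = SubP.x∈p∪q⁺ {p = q} (inj₂ (∈⋃⁺ p∈ x∈))

∈⋃⁻ : ∀ {n} {x : Fin n} (ps : List (Subset n)) → x ∈ ⋃ ps → ∃[ p ] p ∈ᴸ ps × x ∈ p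
∈⋃⁻ List.[] x∈ = contradiction x∈ SubP.∉⊥
∈⋃⁻ (q List.∷ ps) x∈ with SubP.x∈p∪q⁻ q (⋃ ps) x∈
... | inj₁ x∈q = q , here refl , x∈q
... | inj₂ x∈ps = let p , p∈ , x∈p = ∈⋃⁻ ps x∈ps in p , there p∈ , x∈p

-- Hall's condition and augmentation

module _ {n k} (B : Fin k → Subset n) where

  ∈VS⁺ : ∀ {S v i} → i ∈ S → v ∈ B i → v ∈ VS B S
  ∈VS⁺ {S} {i = i} i∈ v∈ = ∈⋃⁺ (MemP.∈-map⁺ B (MemP.∈-filter⁺ (SubP._∈? S) (MemP.∈-allFin i) i∈)) v∈

  ∈VS⁻ : ∀ {S v} → v ∈ VS B S → ∃[ i ] i ∈ S × v ∈ B i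
  ∈VS⁻ {S} {v} v∈ with ∈⋃⁻ (map B (filter (SubP._∈? S) (allFin k))) v∈
  ... | p , p∈ , v∈p with MemP.∈-map⁻ B p∈
  ...   | i , i∈ , refl = i , proj₂ (MemP.∈-filter⁻ (SubP._∈? S) {xs = allFin k} i∈) , v∈p

  Valid : (Fin n → Fin k) → Set
  Valid f = ∀ v → v ∈ B (f v)

  sum-fibre-over : ∀ (f : Fin n → Fin k) (S : Subset k) →
    ΣOver S (fibre f) ≡ sumℕ (λ v → ind (f v SubP.∈? S))
  sum-fibre-over f S = trans (ΣOver≡sum S (fibre f)) (sum-fibre f (λ i → ind (i SubP.∈? S)))

  fibre-admissible : ∀ f → Valid f → Admissible B (fibre f)
  fibre-admissible f valid = trans (Σℕ≡sum (fibre f)) (sum-fibre≡n f) , λ S _ → begin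
    ΣOver S (fibre f)                      ≡⟨ sum-fibre-over f S ⟩
    sumℕ (λ v → ind (f v SubP.∈? S))        ≤⟨ sum-mono (λ v → ind-mono (f v SubP.∈? S) (v SubP.∈? VS B S)
                                                    (λ i∈ → ∈VS⁺ i∈ (valid v))) ⟩
    sumℕ (λ v → ind (v SubP.∈? VS B S))     ≡⟨ ∣p∣≡sum (VS B S) ⟨
    ∣ VS B S ∣                             ∎
    where open ℕP.≤-Reasoning

  -- f′ moves one unit of fibre size from j to i; stated additively to avoid truncated subtraction.
  Shift : (f f′ : Fin n → Fin k) (i j : Fin k) → Set
  Shift f f′ i j = ∀ l → fibre f′ l ℕ.+ ind (j FinP.≟ l) ≡ fibre f l ℕ.+ ind (i FinP.≟ l)

  update-shift : ∀ (f : Fin n → Fin k) v j → Shift f (updateAt f v (const j)) j (f v)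
  update-shift f v j l = trans
    (sum-exchange v (λ u u≢v → cong (λ z → ind (z FinP.≟ l)) (updateAt-minimal u v f u≢v)))
    (cong (λ z → fibre f l ℕ.+ ind (z FinP.≟ l)) (updateAt-updates v f))

  -- The blocks from which a unit can be moved to i by a chain of single-vertex reassignments:
  -- as long as some such j contains a vertex assigned outside, that vertex's block can be added.
  module _ (f : Fin n → Fin k) (valid : Valid f) (i : Fin k) where

    Movable : Subset k → Fin k → Set
    Movable S j = ∃[ f′ ] Valid f′ × Shift f f′ i j × (∀ v → f v ∉ S → f′ v ≡ f v)

    saturate : ∃[ S ] i ∈ S × (∀ j → j ∈ S → Movable S j) × (∀ j v → j ∈ S → v ∈ B j → f v ∈ S)
    saturate = go (suc k) ⁅ i ⁆ (s≤s (ℕP.m∸n≤m k ∣ ⁅ i ⁆ ∣)) (SubP.x∈⁅x⁆ i) λ j j∈ →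
        f , valid , (λ l → cong (λ z → fibre f l ℕ.+ ind (z FinP.≟ l)) (SubP.x∈⁅y⁆⇒x≡y i j∈)) , λ _ _ → refl
      where
      go : ∀ d S → k ∸ ∣ S ∣ < d → i ∈ S → (∀ j → j ∈ S → Movable S j) →
        ∃[ S ] i ∈ S × (∀ j → j ∈ S → Movable S j) × (∀ j v → j ∈ S → v ∈ B j → f v ∈ S)
      go (suc d) S lt i∈ mov
        with FinP.any? (λ j → FinP.any? (λ v → (j SubP.∈? S) ×-dec (v SubP.∈? B j) ×-dec ¬? (f v SubP.∈? S)))
      ... | no none = S , i∈ , mov , λ j v j∈ v∈ →
              decidable-stable (f v SubP.∈? S) λ ∉S → none (j , v , j∈ , v∈ , ∉S)
      ... | yes (j , v , j∈ , v∈ , fv∉) = go d S′ lt′ (SubP.p⊆p∪q ⁅ f v ⁆ i∈) mov′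
        where
        S′ = S ∪ ⁅ f v ⁆
        fv∈ : f v ∈ S′
        fv∈ = SubP.q⊆p∪q S ⁅ f v ⁆ (SubP.x∈⁅x⁆ (f v))
        lt′ : k ∸ ∣ S′ ∣ < d
        lt′ = ℕP.<-≤-trans
          (ℕP.∸-monoʳ-< (SubP.p⊂q⇒∣p∣<∣q∣ {p = S} {S′} (SubP.p⊆p∪q ⁅ f v ⁆ , f v , fv∈ , fv∉)) (SubP.∣p∣≤n S′))
          (ℕP.≤-pred lt)
        mov′ : ∀ j → j ∈ S′ → Movable S′ j
        mov′ l l∈ with SubP.x∈p∪q⁻ S ⁅ f v ⁆ l∈
        ... | inj₁ l∈S = let f′ , val , sh , off = mov l l∈S in
          f′ , val , sh , λ u u∉ → off u (u∉ ∘ SubP.p⊆p∪q ⁅ f v ⁆)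
        -- Since `f v` is outside `S`, the chain so far has left `v` where it was. Reassigning `v`
        -- to `j` refunds the unit taken from `j` and takes it from `f v` instead.
        ... | inj₂ l≡ with SubP.x∈⁅y⁆⇒x≡y (f v) l≡ | mov j j∈
        ...   | refl | f′ , val , sh , off = updateAt f′ v (const j) , val″ , sh″ , off″
          where
          val″ : Valid (updateAt f′ v (const j))
          val″ u with u FinP.≟ v
          ... | yes refl = subst (λ z → u ∈ B z) (sym (updateAt-updates v f′)) v∈
          ... | no  u≢v  = subst (λ z → u ∈ B z) (sym (updateAt-minimal u v f′ u≢v)) (val u)
          sh″ : Shift f (updateAt f′ v (const j)) i (f v)
          sh″ t = trans (cong (λ z → fibre (updateAt f′ v (const j)) t ℕ.+ ind (z FinP.≟ t)) (sym (off v fv∉)))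
                        (trans (update-shift f′ v j t) (sh t))
          off″ : ∀ u → f u ∉ S′ → updateAt f′ v (const j) u ≡ f u
          off″ u u∉ = trans (updateAt-minimal u v f′ (λ u≡v → u∉ (subst (λ z → f z ∈ S′) (sym u≡v) fv∈)))
                            (off u (u∉ ∘ SubP.p⊆p∪q ⁅ f v ⁆))

  module _ (α : Fin k → ℕ) (adm : Admissible B α) where

    deficiency : (Fin n → Fin k) → ℕ
    deficiency f = sumℕ (λ l → α l ∸ fibre f l)

    -- Otherwise the shortfall at `i` makes the fibres over `S` total less than `α` does there.
    -- Hall's condition bounds that total of `α` by the number of vertices in the blocks of `S`, and
    -- all these vertices are assigned into `S` by closedness.
    overfull : ∀ f S i → i ∈ S → fibre f i < α i → (∀ j v → j ∈ S → v ∈ B j → f v ∈ S) →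
      ∃[ j ] j ∈ S × α j < fibre f j
    overfull f S i i∈ lt closed
      with FinP.any? (λ j → (j SubP.∈? S) ×-dec (α j ℕP.<? fibre f j))
    ... | yes p = p
    ... | no none = contradiction (ℕP.<-≤-trans below above) (ℕP.<-irrefl refl)
      where
      S? : Fin k → ℕ
      S? j = ind (j SubP.∈? S)
      le : ∀ j → S? j ℕ.* fibre f j ≤ S? j ℕ.* α j
      le j with j SubP.∈? S
      ... | yes j∈ = ℕP.*-monoʳ-≤ 1 (ℕP.≮⇒≥ (λ lt → none (j , j∈ , lt)))
      ... | no  _  = z≤n
      below : sumℕ (λ j → S? j ℕ.* fibre f j) < sumℕ (λ j → S? j ℕ.* α j)
      below = sum-mono-< le i (subst (λ z → z ℕ.* fibre f i < z ℕ.* α i) (sym (ind-yes (i SubP.∈? S) i∈))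
                (ℕP.*-monoʳ-< 1 lt))
      above : sumℕ (λ j → S? j ℕ.* α j) ≤ sumℕ (λ j → S? j ℕ.* fibre f j)
      above = begin
        sumℕ (λ j → S? j ℕ.* α j)              ≡⟨ ΣOver≡sum S α ⟨
        ΣOver S α                           ≤⟨ proj₂ adm S (i , i∈) ⟩
        ∣ VS B S ∣                          ≡⟨ ∣p∣≡sum (VS B S) ⟩
        sumℕ (λ v → ind (v SubP.∈? VS B S))  ≤⟨ sum-mono (λ v → ind-mono (v SubP.∈? VS B S) (f v SubP.∈? S)
                                                 (λ v∈ → let j , j∈ , v∈B = ∈VS⁻ v∈ in closed j v j∈ v∈B)) ⟩
        sumℕ (λ v → S? (f v))                ≡⟨ sum-fibre f S? ⟨
        sumℕ (λ j → S? j ℕ.* fibre f j)        ∎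
        where open ℕP.≤-Reasoning

    -- Truncated subtraction records only shortfalls: block `j` has a vertex to spare, so its term
    -- stays zero, while the term of `i` falls by one.
    shift-deficiency : ∀ f f′ i j → fibre f i < α i → α j < fibre f j → Shift f f′ i j →
      deficiency f′ < deficiency f
    shift-deficiency f f′ i j i-lt j-gt sh = sum-mono-< le i lt
      where
      i≢j : i ≢ j
      i≢j refl = ℕP.<-asym i-lt j-gt
      le : ∀ l → α l ∸ fibre f′ l ≤ α l ∸ fibre f l
      le l with j FinP.≟ l | sh l
      ... | no  _ | e = ℕP.∸-monoʳ-≤ (α l) (begin
        fibre f l                           ≤⟨ ℕP.m≤m+n _ _ ⟩
        fibre f l ℕ.+ ind (i FinP.≟ l)        ≡⟨ e ⟨
        fibre f′ l ℕ.+ 0                      ≡⟨ ℕP.+-identityʳ _ ⟩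
        fibre f′ l                          ∎)
        where open ℕP.≤-Reasoning
      ... | yes refl | e = ℕP.≤-trans (ℕP.≤-reflexive (ℕP.m≤n⇒m∸n≡0 (ℕP.≤-pred (begin
        suc (α l)                           ≤⟨ j-gt ⟩
        fibre f l                           ≤⟨ ℕP.m≤m+n _ _ ⟩
        fibre f l ℕ.+ ind (i FinP.≟ l)        ≡⟨ e ⟨
        fibre f′ l ℕ.+ 1                      ≡⟨ ℕP.+-comm _ 1 ⟩
        suc (fibre f′ l)                    ∎)))) z≤n
        where open ℕP.≤-Reasoning
      fi : fibre f′ i ≡ suc (fibre f i)
      fi = begin
        fibre f′ i                          ≡⟨ ℕP.+-identityʳ _ ⟨
        fibre f′ i ℕ.+ 0                      ≡⟨ cong (fibre f′ i ℕ.+_) (ind-no (j FinP.≟ i) (i≢j ∘ sym)) ⟨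
        fibre f′ i ℕ.+ ind (j FinP.≟ i)       ≡⟨ sh i ⟩
        fibre f i ℕ.+ ind (i FinP.≟ i)        ≡⟨ cong (fibre f i ℕ.+_) (ind-yes (i FinP.≟ i) refl) ⟩
        fibre f i ℕ.+ 1                       ≡⟨ ℕP.+-comm _ 1 ⟩
        suc (fibre f i)                     ∎
        where open ≡-Reasoning
      lt : α i ∸ fibre f′ i < α i ∸ fibre f i
      lt = subst (λ z → α i ∸ z < α i ∸ fibre f i) (sym fi) (ℕP.∸-monoʳ-< (ℕP.n<1+n _) i-lt)

    realise : ∀ f → Valid f → ∃[ f′ ] Valid f′ × fibre f′ ≗ α
    realise f valid = go (suc (deficiency f)) f valid ℕP.≤-refl
      where
      go : ∀ d f → Valid f → deficiency f < d → ∃[ f′ ] Valid f′ × fibre f′ ≗ α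
      go (suc d) f valid lt with FinP.any? (λ i → fibre f i ℕP.<? α i)
      ... | yes (i , i-lt) =
        let S , i∈ , mov , closed = saturate f valid i
            j , j∈ , j-gt         = overfull f S i i∈ i-lt closed
            f′ , valid′ , sh , _  = mov j j∈
        in go d f′ valid′ (ℕP.<-≤-trans (shift-deficiency f f′ i j i-lt j-gt sh) (ℕP.≤-pred lt))
      -- No block falls short and both totals are `n`, so no block can be overfull either.
      ... | no none = f , valid , λ i → ℕP.≤-antisym
              (ℕP.≮⇒≥ (λ α<f → ℕP.<-irrefl total (sum-mono-< α≤ i α<f))) (α≤ i)
        where
        α≤ : ∀ l → α l ≤ fibre f l
        α≤ l = ℕP.≮⇒≥ (λ lt → none (l , lt))
        total : sumℕ α ≡ sumℕ (fibre f)
        total = trans (sym (Σℕ≡sum α)) (trans (proj₁ adm) (sym (sum-fibre≡n f)))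

-- Uniqueness and existence of block assignments

module BlockAssignments {n} (G : SignedGraph n) {k} (B : Fin k → Subset n) (blocks : AreTheBlocks G B) where
  open Blocks G B blocks

  -- Where f and g differ, equal fibre sizes allow us to follow g and return along f for ever;
  -- the resulting closed walk passes through a single block, contradicting f ≢ g on it.
  fibre-determines : ∀ f g → Valid B f → Valid B g → fibre f ≗ fibre g → f ≗ g
  fibre-determines f g vf vg eq v = decidable-stable (f v FinP.≟ g v) λ f≢g →
    let i , m , closed = orbit-periodic h v
        w₀  = iter h i v
        dif : ∀ t → f (iter h t w₀) ≢ g (iter h t w₀)
        dif t = subst (λ z → f z ≢ g z) (iter-+ h t i v) (along v f≢g (t ℕ.+ i))
        nxt : ∀ t → f (iter h (suc t) w₀) ≡ g (iter h t w₀)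
        nxt t = proj₂ (proj₂ (follow (iter h t w₀)) (dif t))
        one = closed-walk-one-block h g w₀ m closed (λ t → vg _)
                (λ t → subst (λ z → iter h (suc t) w₀ ∈ B z) (nxt t) (vf _))
                (λ t e → dif t (trans (cong f (sym e)) (nxt t)))
    in dif 1 (trans (nxt 0) (sym one))
    where
    follow : ∀ u → ∃[ u′ ] (f u ≢ g u → f u′ ≢ g u′ × f u′ ≡ g u)
    follow u with FinP.any? (λ u′ → ¬? (f u′ FinP.≟ g u′) ×-dec (f u′ FinP.≟ g u))
    ... | yes (u′ , p) = u′ , λ _ → p
    -- The witness `u` is a dummy. If no suitable vertex existed, the fibre of `f` over `g u` would
    -- lie inside that of `g`, which contains `u` in addition, against equal sizes.
    ... | no  none     = u , λ f≢g → contradiction (sum-mono-<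
      (λ u′ → ind-mono (f u′ FinP.≟ g u) (g u′ FinP.≟ g u)
        (λ e → trans (sym (decidable-stable (f u′ FinP.≟ g u′) (λ ne → none (u′ , ne , e)))) e)) u
      (subst₂ _<_ (sym (ind-no (f u FinP.≟ g u) f≢g)) (sym (ind-yes (g u FinP.≟ g u) refl)) (s≤s z≤n)))
      (ℕP.<-irrefl (eq (g u)))
    h : Fin n → Fin n
    h u = proj₁ (follow u)
    along : ∀ u → f u ≢ g u → ∀ t → f (iter h t u) ≢ g (iter h t u)
    along u ne zero    = ne
    along u ne (suc t) = proj₁ (proj₂ (follow (iter h t u)) (along u ne t))

  injective-blocks-constant : ∀ σ → IsInjective σ → ∀ (f : Fin n → Fin k) →
    (∀ v → v ∈ B (f v) × σ v ∈ B (f v) × v ≢ σ v) → ∀ v → f (σ v) ≡ f v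
  injective-blocks-constant σ inj f on v =
    let m , closed = injective-periodic σ inj v in
    closed-walk-one-block σ f v m closed (λ t → proj₁ (on _)) (λ t → proj₁ (proj₂ (on _)))
      (λ t e → proj₂ (proj₂ (on _)) (sym e))

  realise-admissible : ∀ α → Admissible B α → ∃[ f ] Valid B f × fibre f ≗ α
  realise-admissible α adm = realise B α adm (λ v → proj₁ (vertex-in-block v)) (λ v → proj₂ (vertex-in-block v))

-- Sums over functions and permanents

x≡0⇒x*y≡0 : ∀ {x} y → x ≡ 0ℤ → x * y ≡ 0ℤ
x≡0⇒x*y≡0 y refl = ℤP.*-zeroˡ y

0*x+y≡y : ∀ x y → 0ℤ * x + y ≡ y
0*x+y≡y = solve-∀

x*[y*z]≡y*[x*z] : ∀ x y z → x * (y * z) ≡ y * (x * z)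
x*[y*z]≡y*[x*z] = solve-∀

𝟙 : ∀ {P : Set} → Dec P → ℤ
𝟙 d = if does d then 1ℤ else 0ℤ

𝟙-yes : ∀ {P : Set} (d : Dec P) → P → 𝟙 d ≡ 1ℤ
𝟙-yes d p rewrite dec-true d p = refl

𝟙-no : ∀ {P : Set} (d : Dec P) → ¬ P → 𝟙 d ≡ 0ℤ
𝟙-no d p rewrite dec-false d p = refl

𝟙-cong : ∀ {P Q : Set} (d : Dec P) (e : Dec Q) → (P → Q) → (Q → P) → 𝟙 d ≡ 𝟙 e
𝟙-cong (yes p) e f g = sym (𝟙-yes e (f p))
𝟙-cong (no ¬p) e f g = sym (𝟙-no e (¬p ∘ g))

𝟙-× : ∀ {P Q : Set} (d : Dec P) (e : Dec Q) → 𝟙 d * 𝟙 e ≡ 𝟙 (d ×-dec e)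
𝟙-× (yes p) e = trans (ℤP.*-identityˡ (𝟙 e)) (𝟙-cong e (yes p ×-dec e) (p ,_) proj₂)
𝟙-× (no _)  e = ℤP.*-zeroˡ (𝟙 e)

∏-𝟙 : ∀ {n} {P : Fin n → Set} (P? : ∀ v → Dec (P v)) → ∏ (λ v → 𝟙 (P? v)) ≡ 𝟙 (FinP.all? P?)
∏-𝟙 {zero}  P? = sym (𝟙-yes (FinP.all? P?) λ ())
∏-𝟙 {suc n} P? = begin
  𝟙 (P? Fin.zero) * ∏ (λ v → 𝟙 (P? (Fin.suc v)))        ≡⟨ cong (𝟙 (P? Fin.zero) *_) (∏-𝟙 (P? ∘ Fin.suc)) ⟩
  𝟙 (P? Fin.zero) * 𝟙 (FinP.all? (P? ∘ Fin.suc))        ≡⟨ 𝟙-× (P? Fin.zero) (FinP.all? (P? ∘ Fin.suc)) ⟩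
  𝟙 (P? Fin.zero ×-dec FinP.all? (P? ∘ Fin.suc))        ≡⟨ 𝟙-cong (P? Fin.zero ×-dec FinP.all? (P? ∘ Fin.suc)) (FinP.all? P?)
       (λ { (p , q) Fin.zero → p ; (p , q) (Fin.suc v) → q v }) (λ p → p Fin.zero , p ∘ Fin.suc) ⟩
  𝟙 (FinP.all? P?)                                      ∎
  where open ≡-Reasoning

∏-zero : ∀ {n} (g : Fin n → ℤ) v → g v ≡ 0ℤ → ∏ g ≡ 0ℤ
∏-zero g Fin.zero    e = x≡0⇒x*y≡0 (∏ (g ∘ Fin.suc)) e
∏-zero g (Fin.suc v) e = trans (cong (g Fin.zero *_) (∏-zero (g ∘ Fin.suc) v e)) (ℤP.*-zeroʳ (g Fin.zero))

∏-one : ∀ {n} (g : Fin n → ℤ) → (∀ v → g v ≡ 1ℤ) → ∏ g ≡ 1ℤ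
∏-one {zero}  g e = refl
∏-one {suc n} g e = trans (cong₂ _*_ (e Fin.zero) (∏-one (g ∘ Fin.suc) (e ∘ Fin.suc))) refl

-- The cofactor is expressed through `base`, so that all products that deviate from `base` only at
-- `i` share it.
∏-split : ∀ {n} (g base : Fin n → ℤ) i → (∀ j → j ≢ i → g j ≡ base j) →
  ∏ g ≡ g i * ∏ (λ j → if does (i FinP.≟ j) then 1ℤ else base j)
∏-split {suc n} g base Fin.zero eq = cong (g Fin.zero *_)
  (trans (∏-cong (λ j → eq (Fin.suc j) λ ())) (sym (ℤP.*-identityˡ _)))
∏-split {suc n} g base (Fin.suc i) eq = begin
  g Fin.zero * ∏ (g ∘ Fin.suc)
    ≡⟨ cong₂ _*_ (eq Fin.zero λ ()) (∏-split (g ∘ Fin.suc) (base ∘ Fin.suc) i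
                                       λ j j≢i → eq (Fin.suc j) (j≢i ∘ FinP.suc-injective)) ⟩
  base Fin.zero * (g (Fin.suc i) * rest)
    ≡⟨ x*[y*z]≡y*[x*z] (base Fin.zero) (g (Fin.suc i)) rest ⟩
  g (Fin.suc i) * (base Fin.zero * rest) ∎
  where
  open ≡-Reasoning
  rest = ∏ (λ j → if does (i FinP.≟ j) then 1ℤ else base (Fin.suc j))

∑-zero : ∀ {n} {g : Fin n → ℤ} → (∀ i → g i ≡ 0ℤ) → ∑ g ≡ 0ℤ
∑-zero {n} e = trans (∑-cong e) (∑-zeros n)

∑-single : ∀ {n} (g : Fin n → ℤ) i → (∀ j → j ≢ i → g j ≡ 0ℤ) → ∑ g ≡ g i
∑-single g Fin.zero    e = trans (cong (_+_ (g Fin.zero)) (∑-zero (λ j → e (Fin.suc j) λ ()))) (ℤP.+-identityʳ _)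
∑-single g (Fin.suc i) e = trans (cong (_+ ∑ (g ∘ Fin.suc)) (e Fin.zero λ ()))
  (trans (ℤP.+-identityˡ _) (∑-single (g ∘ Fin.suc) i λ j j≢i → e (Fin.suc j) (j≢i ∘ FinP.suc-injective)))

-- The recursion mirrors that of `allFuns`, while binary sums over functions become nested finite
-- sums that can be interchanged.
∑F : ∀ {k m} → ((Fin k → Fin m) → ℤ) → ℤ
∑F {zero}  F = F (λ ())
∑F {suc k} F = ∑ (λ x → ∑F (λ f → F (x ∷ᶠ f)))

-- The enumeration reaches a given function only up to pointwise equality, so a summand must respect
-- it before single terms can be picked out.
Extensional : ∀ {k m} → ((Fin k → Fin m) → ℤ) → Set
Extensional F = ∀ {f g} → f ≗ g → F f ≡ F g

∷ᶠ-cong : ∀ {k m} (x : Fin m) {f g : Fin k → Fin m} → f ≗ g → (x ∷ᶠ f) ≗ (x ∷ᶠ g)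
∷ᶠ-cong x e Fin.zero    = refl
∷ᶠ-cong x e (Fin.suc i) = e i

∑F-cong : ∀ {k m} {F G : (Fin k → Fin m) → ℤ} → (∀ f → F f ≡ G f) → ∑F F ≡ ∑F G
∑F-cong {zero}  e = e _
∑F-cong {suc k} e = ∑-cong (λ x → ∑F-cong (λ f → e (x ∷ᶠ f)))

∑F-zero : ∀ {k m} {F : (Fin k → Fin m) → ℤ} → (∀ f → F f ≡ 0ℤ) → ∑F F ≡ 0ℤ
∑F-zero {zero}  e = e _
∑F-zero {suc k} e = ∑-zero (λ x → ∑F-zero (λ f → e (x ∷ᶠ f)))

*-∑F : ∀ {k m} c (F : (Fin k → Fin m) → ℤ) → c * ∑F F ≡ ∑F (λ f → c * F f)
*-∑F {zero}  c F = refl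
*-∑F {suc k} c F = trans (*-∑ c (λ x → ∑F (λ f → F (x ∷ᶠ f)))) (∑-cong (λ x → *-∑F c (λ f → F (x ∷ᶠ f))))

∑-∑F-comm : ∀ {n k m} (H : Fin n → (Fin k → Fin m) → ℤ) → ∑ (λ x → ∑F (H x)) ≡ ∑F (λ f → ∑ (λ x → H x f))
∑-∑F-comm {k = zero}  H = refl
∑-∑F-comm {k = suc k} H = trans (∑-comm (λ x y → ∑F (λ f → H x (y ∷ᶠ f))))
  (∑-cong (λ y → ∑-∑F-comm (λ x f → H x (y ∷ᶠ f))))

∑F-comm : ∀ {k m l p} (H : (Fin k → Fin m) → (Fin l → Fin p) → ℤ) →
  ∑F (λ f → ∑F (H f)) ≡ ∑F (λ g → ∑F (λ f → H f g))
∑F-comm {zero}  H = refl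
∑F-comm {suc k} H = trans (∑-cong (λ x → ∑F-comm (λ f → H (x ∷ᶠ f))))
  (∑-∑F-comm (λ x g → ∑F (λ f → H (x ∷ᶠ f) g)))

∑F-single : ∀ {k m} (F : (Fin k → Fin m) → ℤ) → Extensional F → ∀ f₀ →
  (∀ f → ¬ (f ≗ f₀) → F f ≡ 0ℤ) → ∑F F ≡ F f₀
∑F-single {zero}  F ext f₀ e = ext (λ ())
∑F-single {suc k} F ext f₀ e = begin
  ∑ (λ x → ∑F (λ f → F (x ∷ᶠ f)))
    ≡⟨ ∑-single _ (f₀ Fin.zero) (λ x x≢ → ∑F-zero (λ f → e (x ∷ᶠ f) (λ eq → x≢ (eq Fin.zero)))) ⟩
  ∑F (λ f → F (f₀ Fin.zero ∷ᶠ f))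
    ≡⟨ ∑F-single (λ f → F (f₀ Fin.zero ∷ᶠ f)) (λ eq → ext (∷ᶠ-cong _ eq)) (f₀ ∘ Fin.suc)
         (λ f ne → e _ (λ eq → ne (eq ∘ Fin.suc))) ⟩
  F (f₀ Fin.zero ∷ᶠ (f₀ ∘ Fin.suc))
    ≡⟨ ext (λ { Fin.zero → refl ; (Fin.suc i) → refl }) ⟩
  F f₀ ∎
  where open ≡-Reasoning

sumℤ-++ : ∀ xs ys → sumℤ (xs ++ ys) ≡ sumℤ xs + sumℤ ys
sumℤ-++ List.[]       ys = sym (ℤP.+-identityˡ _)
sumℤ-++ (x List.∷ xs) ys = trans (cong (_+_ x) (sumℤ-++ xs ys)) (sym (ℤP.+-assoc x _ _))

sumℤ-concatMap : ∀ {A B : Set} (g : B → ℤ) (h : A → List B) xs →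
  sumℤ (map g (concatMap h xs)) ≡ sumℤ (map (λ x → sumℤ (map g (h x))) xs)
sumℤ-concatMap g h List.[]       = refl
sumℤ-concatMap g h (x List.∷ xs) = begin
  sumℤ (map g (h x ++ concatMap h xs))                    ≡⟨ cong sumℤ (ListP.map-++ g (h x) (concatMap h xs)) ⟩
  sumℤ (map g (h x) ++ map g (concatMap h xs))            ≡⟨ sumℤ-++ (map g (h x)) _ ⟩
  sumℤ (map g (h x)) + sumℤ (map g (concatMap h xs))      ≡⟨ cong (_+_ (sumℤ (map g (h x)))) (sumℤ-concatMap g h xs) ⟩
  sumℤ (map g (h x)) + sumℤ (map (λ x → sumℤ (map g (h x))) xs) ∎
  where open ≡-Reasoning

sumℤ-filter : ∀ {A : Set} {P : A → Set} (P? : ∀ x → Dec (P x)) (g : A → ℤ) xs →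
  sumℤ (map g (filter P? xs)) ≡ sumℤ (map (λ x → 𝟙 (P? x) * g x) xs)
sumℤ-filter P? g List.[] = refl
sumℤ-filter P? g (x List.∷ xs) with P? x
... | yes _ = cong₂ _+_ (sym (ℤP.*-identityˡ (g x))) (sumℤ-filter P? g xs)
... | no  _ = trans (sumℤ-filter P? g xs) (sym (0*x+y≡y (g x) _))

sumℤ-allFin : ∀ {n} (g : Fin n → ℤ) → sumℤ (map g (allFin n)) ≡ ∑ g
sumℤ-allFin g = trans (cong sumℤ (ListP.map-tabulate id g)) (foldr-tabulate _+_ 0ℤ g)

sumℤ-allFuns : ∀ k m (F : (Fin k → Fin m) → ℤ) → sumℤ (map F (allFuns k m)) ≡ ∑F F
sumℤ-allFuns zero    m F = ℤP.+-identityʳ _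
sumℤ-allFuns (suc k) m F = begin
  sumℤ (map F (allFuns (suc k) m))
    ≡⟨ sumℤ-concatMap F (λ x → map (x ∷ᶠ_) (allFuns k m)) (allFin m) ⟩
  sumℤ (map (λ x → sumℤ (map F (map (x ∷ᶠ_) (allFuns k m)))) (allFin m))
    ≡⟨ sumℤ-allFin {m} _ ⟩
  ∑ (λ x → sumℤ (map F (map (x ∷ᶠ_) (allFuns k m))))
    ≡⟨ ∑-cong (λ x → trans (cong sumℤ (sym (ListP.map-∘ (allFuns k m)))) (sumℤ-allFuns k m (λ f → F (x ∷ᶠ f)))) ⟩
  ∑F F ∎
  where open ≡-Reasoning

Πℤ≡∏ : ∀ {n} (g : Fin n → ℤ) → Πℤ g ≡ ∏ g
Πℤ≡∏ g = trans (sym (ListP.foldr-map _*_ g 1ℤ (allFin _)))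
  (trans (cong (foldr _*_ 1ℤ) (ListP.map-tabulate id g)) (foldr-tabulate _*_ 1ℤ g))

perTerm : ∀ {n} → (Fin n → Fin n → ℤ) → (Fin n → Fin n) → ℤ
perTerm A σ = 𝟙 (isInjective? σ) * ∏ (λ i → A i (σ i))

per≡∑F : ∀ {n} (A : Fin n → Fin n → ℤ) → per A ≡ ∑F (perTerm A)
per≡∑F {n} A = begin
  per A
    ≡⟨ sumℤ-filter isInjective? _ (allFuns n n) ⟩
  sumℤ (map (λ σ → 𝟙 (isInjective? σ) * Πℤ (λ i → A i (σ i))) (allFuns n n))
    ≡⟨ sumℤ-allFuns n n _ ⟩
  ∑F (λ σ → 𝟙 (isInjective? σ) * Πℤ (λ i → A i (σ i)))
    ≡⟨ ∑F-cong (λ σ → cong (𝟙 (isInjective? σ) *_) (Πℤ≡∏ (λ i → A i (σ i)))) ⟩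
  ∑F (perTerm A) ∎
  where open ≡-Reasoning

IsInjective-resp : ∀ {n} {σ τ : Fin n → Fin n} → σ ≗ τ → IsInjective σ → IsInjective τ
IsInjective-resp e inj i j τ≡ = inj i j (trans (e i) (trans τ≡ (sym (e j))))

perTerm-ext : ∀ {n} (A : Fin n → Fin n → ℤ) → Extensional (perTerm A)
perTerm-ext A {σ} {τ} e = cong₂ _*_
  (𝟙-cong (isInjective? σ) (isInjective? τ) (IsInjective-resp e) (IsInjective-resp (sym ∘ e)))
  (∏-cong (λ i → cong (A i) (e i)))

per-cong : ∀ {n} {A A′ : Fin n → Fin n → ℤ} → (∀ i j → A i j ≡ A′ i j) → per A ≡ per A′
per-cong {A = A} {A′} e = trans (per≡∑F A) (trans
  (∑F-cong (λ σ → cong (𝟙 (isInjective? σ) *_) (∏-cong (λ i → e i (σ i))))) (sym (per≡∑F A′)))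

-- Enumerates Fin (suc n) minus w, with zero put in the place of w.
skip : ∀ {n} → Fin (suc n) → Fin n → Fin (suc n)
skip w c = if does (Fin.suc c FinP.≟ w) then Fin.zero else Fin.suc c

skip-≢ : ∀ {n} (w : Fin (suc n)) c → skip w c ≢ w
skip-≢ w c with Fin.suc c FinP.≟ w
... | yes refl = λ ()
... | no  ne   = ne

skip-injective : ∀ {n} (w : Fin (suc n)) c d → skip w c ≡ skip w d → c ≡ d
skip-injective w c d with Fin.suc c FinP.≟ w | Fin.suc d FinP.≟ w
... | yes refl | yes e = λ _ → sym (FinP.suc-injective e)
... | yes _    | no  _ = λ ()
... | no  _    | yes _ = λ ()
... | no  _    | no  _ = FinP.suc-injective

-- Reindexing puts the value at zero in the slot of `w`, whose own value vanishes, so the total is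
-- unchanged.
∑-skip : ∀ {n} (w : Fin (suc n)) (H : Fin (suc n) → ℤ) → H w ≡ 0ℤ → ∑ H ≡ ∑ (H ∘ skip w)
∑-skip Fin.zero H e = trans (cong (_+ ∑ (H ∘ Fin.suc)) e) (ℤP.+-identityˡ _)
∑-skip (Fin.suc u) H e = sym (begin
  ∑ (H ∘ skip (Fin.suc u))                    ≡⟨ ∑-cong eq ⟩
  ∑ (λ c → H (Fin.suc c) + 𝟙 (u FinP.≟ c) * H Fin.zero) ≡⟨ ∑-+ (H ∘ Fin.suc) _ ⟩
  ∑ (H ∘ Fin.suc) + ∑ (λ c → 𝟙 (u FinP.≟ c) * H Fin.zero)
    ≡⟨ cong (_+_ (∑ (H ∘ Fin.suc))) (∑-single (λ c → 𝟙 (u FinP.≟ c) * H Fin.zero) u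
         (λ c c≢u → x≡0⇒x*y≡0 (H Fin.zero) (𝟙-no (u FinP.≟ c) (c≢u ∘ sym)))) ⟩
  ∑ (H ∘ Fin.suc) + 𝟙 (u FinP.≟ u) * H Fin.zero
    ≡⟨ cong (_+_ (∑ (H ∘ Fin.suc))) (trans (cong (_* H Fin.zero) (𝟙-yes (u FinP.≟ u) refl)) (ℤP.*-identityˡ _)) ⟩
  ∑ (H ∘ Fin.suc) + H Fin.zero                ≡⟨ ℤP.+-comm _ (H Fin.zero) ⟩
  ∑ H                                         ∎)
  where
  open ≡-Reasoning
  eq : ∀ c → H (skip (Fin.suc u) c) ≡ H (Fin.suc c) + 𝟙 (u FinP.≟ c) * H Fin.zero
  eq c with c FinP.≟ u
  ... | yes refl rewrite 𝟙-yes (c FinP.≟ c) refl | e = sym (trans (ℤP.+-identityˡ _) (ℤP.*-identityˡ _))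
  ... | no ne rewrite 𝟙-no (u FinP.≟ c) (ne ∘ sym) | ℤP.*-zeroˡ (H Fin.zero) = sym (ℤP.+-identityʳ _)

∑F-skip : ∀ {k n} (w : Fin (suc n)) (F : (Fin k → Fin (suc n)) → ℤ) → Extensional F →
  (∀ f i → f i ≡ w → F f ≡ 0ℤ) → ∑F F ≡ ∑F (λ σ → F (skip w ∘ σ))
∑F-skip {zero}  w F ext e = ext (λ ())
∑F-skip {suc k} w F ext e = begin
  ∑ (λ x → ∑F (λ f → F (x ∷ᶠ f)))
    ≡⟨ ∑-skip w (λ x → ∑F (λ f → F (x ∷ᶠ f))) (∑F-zero (λ f → e (w ∷ᶠ f) Fin.zero refl)) ⟩
  ∑ (λ c → ∑F (λ f → F (skip w c ∷ᶠ f)))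
    ≡⟨ ∑-cong (λ c → ∑F-skip w (λ f → F (skip w c ∷ᶠ f)) (λ eq → ext (∷ᶠ-cong _ eq))
         (λ f i → e (skip w c ∷ᶠ f) (Fin.suc i))) ⟩
  ∑ (λ c → ∑F (λ σ → F (skip w c ∷ᶠ (skip w ∘ σ))))
    ≡⟨ ∑-cong (λ c → ∑F-cong (λ σ → ext {skip w c ∷ᶠ (skip w ∘ σ)} {skip w ∘ (c ∷ᶠ σ)}
         (λ { Fin.zero → refl ; (Fin.suc i) → refl }))) ⟩
  ∑ (λ c → ∑F (λ σ → F (skip w ∘ (c ∷ᶠ σ)))) ∎
  where open ≡-Reasoning

-- Once zero is sent to `w`, injectivity confines the other images to the complement of `w`, which
-- `skip w` enumerates. A permanent has no signs, so the order of the remaining columns is free.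
per-expand : ∀ {n} (A : Fin (suc n) → Fin (suc n) → ℤ) →
  per A ≡ ∑ (λ w → A Fin.zero w * per (λ u c → A (Fin.suc u) (skip w c)))
per-expand {n} A = trans (per≡∑F A) (∑-cong expand)
  where
  open ≡-Reasoning
  expand : ∀ w → ∑F (λ τ → perTerm A (w ∷ᶠ τ)) ≡ A Fin.zero w * per (λ u c → A (Fin.suc u) (skip w c))
  expand w = begin
    ∑F (λ τ → perTerm A (w ∷ᶠ τ))
      ≡⟨ ∑F-skip w _ (λ e → perTerm-ext A (∷ᶠ-cong w e)) (λ τ i τi≡w →
           x≡0⇒x*y≡0 (∏ (λ i → A i ((w ∷ᶠ τ) i))) (𝟙-no (isInjective? (w ∷ᶠ τ)) (λ inj →
             contradiction (inj Fin.zero (Fin.suc i) (sym τi≡w)) λ ()))) ⟩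
    ∑F (λ σ → perTerm A (w ∷ᶠ (skip w ∘ σ)))
      ≡⟨ ∑F-cong (λ σ → trans
           (cong (_* (A Fin.zero w * ∏ (λ u → A (Fin.suc u) (skip w (σ u)))))
             (𝟙-cong (isInjective? (w ∷ᶠ (skip w ∘ σ))) (isInjective? σ) (inj⁻ σ) (inj⁺ σ)))
           (x*[y*z]≡y*[x*z] (𝟙 (isInjective? σ)) (A Fin.zero w) _)) ⟩
    ∑F (λ σ → A Fin.zero w * perTerm (λ u c → A (Fin.suc u) (skip w c)) σ)
      ≡⟨ *-∑F (A Fin.zero w) (perTerm (λ u c → A (Fin.suc u) (skip w c))) ⟨
    A Fin.zero w * ∑F (perTerm (λ u c → A (Fin.suc u) (skip w c)))
      ≡⟨ cong (A Fin.zero w *_) (per≡∑F (λ u c → A (Fin.suc u) (skip w c))) ⟨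
    A Fin.zero w * per (λ u c → A (Fin.suc u) (skip w c)) ∎
    where
    inj⁻ : ∀ σ → IsInjective (w ∷ᶠ (skip w ∘ σ)) → IsInjective σ
    inj⁻ σ inj i j e = FinP.suc-injective (inj (Fin.suc i) (Fin.suc j) (cong (skip w) e))
    inj⁺ : ∀ σ → IsInjective σ → IsInjective (w ∷ᶠ (skip w ∘ σ))
    inj⁺ σ inj Fin.zero    Fin.zero    e = refl
    inj⁺ σ inj Fin.zero    (Fin.suc j) e = contradiction (sym e) (skip-≢ w (σ j))
    inj⁺ σ inj (Fin.suc i) Fin.zero    e = contradiction e (skip-≢ w (σ i))
    inj⁺ σ inj (Fin.suc i) (Fin.suc j) e = cong Fin.suc (inj i j (skip-injective w (σ i) (σ j) e))

-- Partial derangements and colour-preserving permutations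

-- Permutations of a + b points without fixed points among the last b.
D : ℕ → ℕ → ℤ
D a zero    = + (a !)
D a (suc b) = D (suc a) b - D a b

-- Combinatorially, a barred point is removed from its cycle. If its image was one of the `a` free
-- points, the numbers of other free and barred points stay; if it was one of the `b` other barred
-- points, that image becomes free. The proof is algebraic, from the defining recursion.
D-suc : ∀ a b → D a (suc b) ≡ + a * D a b + + b * D (suc a) (ℕ.pred b)
D-suc a zero = begin
  + (suc a ℕ.* a !) - + (a !)   ≡⟨ cong (_- + (a !)) (ℤP.pos-* (suc a) (a !)) ⟩
  + suc a * + (a !) - + (a !)   ≡⟨ lemma (+ a) (+ (a !)) (+ (suc a !)) ⟩
  + a * + (a !) + + 0 * + (suc a !) ∎
  where
  open ≡-Reasoning
  lemma : ∀ a x y → (+ 1 + a) * x - x ≡ a * x + + 0 * y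
  lemma = solve-∀
D-suc a (suc b) = begin
  D (suc a) (suc b) - D a (suc b)
    ≡⟨ cong₂ _-_ (D-suc (suc a) b) (D-suc a b) ⟩
  (+ suc a * D (suc a) b + + b * D (suc (suc a)) (ℕ.pred b)) - (+ a * D a b + + b * D (suc a) (ℕ.pred b))
    ≡⟨ regroup (+ a) (+ b) (D (suc a) b) (D (suc (suc a)) (ℕ.pred b)) (D a b) (D (suc a) (ℕ.pred b)) ⟩
  + a * D a (suc b) + (D (suc a) b + + b * D (suc a) (suc (ℕ.pred b)))
    ≡⟨ cong (λ z → + a * D a (suc b) + (D (suc a) b + z)) (unpred b) ⟩
  + a * D a (suc b) + (D (suc a) b + + b * D (suc a) b)
    ≡⟨ cong (_+_ (+ a * D a (suc b))) (factor (+ b) (D (suc a) b)) ⟩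
  + a * D a (suc b) + + suc b * D (suc a) b ∎
  where
  open ≡-Reasoning
  regroup : ∀ a b x y z t → ((+ 1 + a) * x + b * y) - (a * z + b * t) ≡ a * (x - z) + (x + b * (y - t))
  regroup = solve-∀
  factor : ∀ b x → x + b * x ≡ (+ 1 + b) * x
  factor = solve-∀
  -- `suc (ℕ.pred b)` differs from `b` only at zero, where the coefficient vanishes.
  unpred : ∀ b → + b * D (suc a) (suc (ℕ.pred b)) ≡ + b * D (suc a) b
  unpred zero    = trans (ℤP.*-zeroˡ (D (suc a) 1)) (sym (ℤP.*-zeroˡ (D (suc a) 0)))
  unpred (suc b) = refl

module _ {k : ℕ} where

  -- Its permanent counts the colour-preserving permutations that fix no marked (p v ≡ true) vertex.
  derangeMatrix : ∀ {n} → (Fin n → Fin k) → (Fin n → Bool) → Fin n → Fin n → ℤ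
  derangeMatrix f p v u = 𝟙 (f v FinP.≟ f u) * (if p v ∧ does (v FinP.≟ u) then 0ℤ else 1ℤ)

  unmarked marked : ∀ {n} → (Fin n → Fin k) → (Fin n → Bool) → Fin k → ℕ
  unmarked f p i = sumℕ (λ v → if p v then 0 else ind (f v FinP.≟ i))
  marked   f p i = sumℕ (λ v → if p v then ind (f v FinP.≟ i) else 0)

  unmark : ∀ {n} → (Fin (suc n) → Bool) → Fin (suc n) → Fin n → Bool
  unmark p w u = p (Fin.suc u) ∧ not (does (Fin.suc u FinP.≟ w))

  -- When `w` is not zero, its column has been replaced by column zero, so entering `w` in the minor
  -- means passing through vertex zero first. A fixed `w` then stands for the 2-cycle of zero and
  -- `w`, which is allowed; hence `w` loses its mark.
  derangeMatrix-minor : ∀ {n} (f : Fin (suc n) → Fin k) p w → f Fin.zero ≡ f w → ∀ u c →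
    derangeMatrix f p (Fin.suc u) (skip w c) ≡ derangeMatrix (f ∘ Fin.suc) (unmark p w) u c
  derangeMatrix-minor f p w eq u c = cong₂ _*_ (cong (λ z → 𝟙 (f (Fin.suc u) FinP.≟ z)) colour)
                                    (cong (λ q → if q then 0ℤ else 1ℤ) (mark (p (Fin.suc u))))
    where
    colour : f (skip w c) ≡ f (Fin.suc c)
    colour with Fin.suc c FinP.≟ w
    ... | yes refl = eq
    ... | no  _    = refl
    mark : ∀ q → q ∧ does (Fin.suc u FinP.≟ skip w c) ≡ (q ∧ not (does (Fin.suc u FinP.≟ w))) ∧ does (u FinP.≟ c)
    mark false = refl
    mark true with Fin.suc c FinP.≟ w
    ... | yes refl = sym (BoolP.∧-inverseˡ (does (u FinP.≟ c)))
    ... | no  ne with u FinP.≟ c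
    ...   | yes refl = cong (λ z → not z ∧ true) (sym (dec-false (Fin.suc u FinP.≟ w) ne))
    ...   | no  _    = sym (BoolP.∧-zeroʳ _)

  ∑-by-mark : ∀ {n} (f : Fin n → Fin k) p i x y →
    ∑ (λ u → 𝟙 (i FinP.≟ f u) * (if p u then y else x)) ≡ + unmarked f p i * x + + marked f p i * y
  ∑-by-mark {zero}  f p i x y = refl
  ∑-by-mark {suc n} f p i x y
    rewrite ∑-by-mark (f ∘ Fin.suc) (p ∘ Fin.suc) i x y
          | 𝟙-cong (i FinP.≟ f Fin.zero) (f Fin.zero FinP.≟ i) sym sym
    with does (f Fin.zero FinP.≟ i) | p Fin.zero
  ... | true  | true  = lemma x y (+ unmarked (f ∘ Fin.suc) (p ∘ Fin.suc) i) (+ marked (f ∘ Fin.suc) (p ∘ Fin.suc) i)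
    where
    lemma : ∀ x y a b → 1ℤ * y + (a * x + b * y) ≡ a * x + (+ 1 + b) * y
    lemma = solve-∀
  ... | true  | false = lemma x y (+ unmarked (f ∘ Fin.suc) (p ∘ Fin.suc) i) (+ marked (f ∘ Fin.suc) (p ∘ Fin.suc) i)
    where
    lemma : ∀ x y a b → 1ℤ * x + (a * x + b * y) ≡ (+ 1 + a) * x + b * y
    lemma = solve-∀
  ... | false | true  = 0*x+y≡y y _
  ... | false | false = 0*x+y≡y x _

  unmarked-cong : ∀ {n} (f : Fin n → Fin k) {p q} → p ≗ q → ∀ i → unmarked f p i ≡ unmarked f q i
  unmarked-cong f e i = sumℕ-cong (λ v → cong (λ b → if b then 0 else ind (f v FinP.≟ i)) (e v))

  marked-cong : ∀ {n} (f : Fin n → Fin k) {p q} → p ≗ q → ∀ i → marked f p i ≡ marked f q i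
  marked-cong f e i = sumℕ-cong (λ v → cong (λ b → if b then ind (f v FinP.≟ i) else 0) (e v))

  countD : ∀ {n} → (Fin n → Fin k) → (Fin n → Bool) → Fin k → ℤ
  countD f p i = D (unmarked f p i) (marked f p i)

  -- Expanding along row zero removes vertex zero from its cycle; its image w may now be a fixed point.
  per-derangeMatrix : ∀ {n} (f : Fin n → Fin k) p → per (derangeMatrix f p) ≡ ∏ (countD f p)
  per-derangeMatrix {zero}  f p = trans (per≡∑F (derangeMatrix f p)) (sym (∏-one (countD f p) (λ _ → refl)))
  per-derangeMatrix {suc n} f p = begin
    per (derangeMatrix f p)
      ≡⟨ per-expand (derangeMatrix f p) ⟩
    ∑ (λ w → derangeMatrix f p Fin.zero w * per (λ u c → derangeMatrix f p (Fin.suc u) (skip w c)))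
      ≡⟨ cong₂ _+_ head-term (∑-cong tail-term) ⟩
    keep * (D a b * rest) + ∑ (λ u → rest * same-colour u)
      ≡⟨ cong (_+_ (keep * (D a b * rest))) (trans (sym (*-∑ rest same-colour)) (cong (rest *_)
           (trans (∑-by-mark f′ p′ i₀ (D a b) (D (suc a) (ℕ.pred b))) (sym (D-suc a b))))) ⟩
    keep * (D a b * rest) + rest * D a (suc b)
      ≡⟨ combine ⟩
    countD f p i₀ * rest
      ≡⟨ ∏-split (countD f p) (countD f′ p′) i₀ off ⟨
    ∏ (countD f p) ∎
    where
    open ≡-Reasoning
    f′ : Fin n → Fin k
    f′ = f ∘ Fin.suc
    p′ : Fin n → Bool
    p′ = p ∘ Fin.suc
    i₀ : Fin k
    i₀ = f Fin.zero
    a b : ℕ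
    a = unmarked f′ p′ i₀
    b = marked f′ p′ i₀
    rest : ℤ
    rest = ∏ (λ j → if does (i₀ FinP.≟ j) then 1ℤ else countD f′ p′ j)
    same-colour : Fin n → ℤ
    same-colour u = 𝟙 (i₀ FinP.≟ f′ u) * (if p′ u then D (suc a) (ℕ.pred b) else D a b)
    keep : ℤ
    keep = if p Fin.zero then 0ℤ else 1ℤ

    off : ∀ j → j ≢ i₀ → countD f p j ≡ countD f′ p′ j
    off j j≢ with p Fin.zero
    ... | true  = cong (λ z → D (unmarked f′ p′ j) (z ℕ.+ marked f′ p′ j)) (ind-no (i₀ FinP.≟ j) (j≢ ∘ sym))
    ... | false = cong (λ z → D (z ℕ.+ unmarked f′ p′ j) (marked f′ p′ j)) (ind-no (i₀ FinP.≟ j) (j≢ ∘ sym))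

    -- For marked zero only the tail survives. For unmarked zero, fixing it contributes `D a b` and
    -- moving it `D a (suc b)`, which add up to `D (suc a) b` by the recursion of `D`.
    combine : keep * (D a b * rest) + rest * D a (suc b) ≡ countD f p i₀ * rest
    combine with p Fin.zero
    ... | true  rewrite ind-yes (i₀ FinP.≟ i₀) refl = lemma (D a b) rest (D a (suc b))
      where
      lemma : ∀ x r y → 0ℤ * (x * r) + r * y ≡ y * r
      lemma = solve-∀
    ... | false rewrite ind-yes (i₀ FinP.≟ i₀) refl = lemma (D a b) rest (D (suc a) b)
      where
      lemma : ∀ x r y → 1ℤ * (x * r) + r * (y - x) ≡ y * r
      lemma = solve-∀

    minor : ∀ w → i₀ ≡ f w → per (λ u c → derangeMatrix f p (Fin.suc u) (skip w c)) ≡ ∏ (countD f′ (unmark p w))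
    minor w eq = trans (per-cong (derangeMatrix-minor f p w eq)) (per-derangeMatrix f′ (unmark p w))

    unchanged : ∀ w → unmark p w ≗ p′ → ∏ (countD f′ (unmark p w)) ≡ D a b * rest
    unchanged w e = trans
      (∏-cong (λ i → cong₂ D (unmarked-cong f′ e i) (marked-cong f′ e i)))
      (∏-split (countD f′ p′) (countD f′ p′) i₀ (λ _ _ → refl))

    head-term : derangeMatrix f p Fin.zero Fin.zero *
      per (λ u c → derangeMatrix f p (Fin.suc u) (skip Fin.zero c)) ≡ keep * (D a b * rest)
    head-term = cong₂ _*_
      (trans (cong₂ _*_ (𝟙-yes (i₀ FinP.≟ i₀) refl)
               (cong (λ q → if q then 0ℤ else 1ℤ) (BoolP.∧-identityʳ (p Fin.zero)))) (ℤP.*-identityˡ keep))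
      (trans (minor Fin.zero refl) (unchanged Fin.zero (λ u → BoolP.∧-identityʳ (p′ u))))

    -- Colour `i₀` trades one marked vertex for an unmarked one. As `u` is marked of this colour,
    -- `b` is positive and `ℕ.pred b` is exact.
    released : ∀ u → p′ u ≡ true → f′ u ≡ i₀ → ∏ (countD f′ (unmark p (Fin.suc u))) ≡ D (suc a) (ℕ.pred b) * rest
    released u pu fu = trans (∏-split (countD f′ q) (countD f′ p′) i₀
        (λ j j≢ → cong₂ D (un-off j j≢) (ma-off j j≢)))
        (cong (_* rest) (cong₂ D un-at (cong ℕ.pred ma-at)))
      where
      q : Fin n → Bool
      q = unmark p (Fin.suc u)
      qu : q u ≡ false
      qu rewrite dec-true (Fin.suc u FinP.≟ Fin.suc u) refl = BoolP.∧-zeroʳ (p′ u)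
      q-else : ∀ v → v ≢ u → q v ≡ p′ v
      q-else v v≢u rewrite dec-false (Fin.suc v FinP.≟ Fin.suc u) (v≢u ∘ FinP.suc-injective) = BoolP.∧-identityʳ (p′ v)
      un : ∀ j → unmarked f′ q j ≡ unmarked f′ p′ j ℕ.+ ind (f′ u FinP.≟ j)
      un j = trans (sym (ℕP.+-identityʳ _)) (subst₂
        (λ r s → unmarked f′ q j ℕ.+ (if r then 0 else ind (f′ u FinP.≟ j))
               ≡ unmarked f′ p′ j ℕ.+ (if s then 0 else ind (f′ u FinP.≟ j))) pu qu
        (sum-exchange u (λ v v≢u → cong (λ r → if r then 0 else ind (f′ v FinP.≟ j)) (q-else v v≢u))))
      ma : ∀ j → marked f′ q j ℕ.+ ind (f′ u FinP.≟ j) ≡ marked f′ p′ j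
      ma j = trans (subst₂
        (λ r s → marked f′ q j ℕ.+ (if r then ind (f′ u FinP.≟ j) else 0)
               ≡ marked f′ p′ j ℕ.+ (if s then ind (f′ u FinP.≟ j) else 0)) pu qu
        (sum-exchange u (λ v v≢u → cong (λ r → if r then ind (f′ v FinP.≟ j) else 0) (q-else v v≢u))))
        (ℕP.+-identityʳ _)
      miss : ∀ j → j ≢ i₀ → ind (f′ u FinP.≟ j) ≡ 0
      miss j j≢ = ind-no (f′ u FinP.≟ j) (λ e → j≢ (trans (sym e) fu))
      un-off : ∀ j → j ≢ i₀ → unmarked f′ q j ≡ unmarked f′ p′ j
      un-off j j≢ = trans (un j) (trans (cong (unmarked f′ p′ j ℕ.+_) (miss j j≢)) (ℕP.+-identityʳ _))
      ma-off : ∀ j → j ≢ i₀ → marked f′ q j ≡ marked f′ p′ j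
      ma-off j j≢ = trans (trans (sym (ℕP.+-identityʳ _)) (cong (marked f′ q j ℕ.+_) (sym (miss j j≢)))) (ma j)
      un-at : unmarked f′ q i₀ ≡ suc a
      un-at = trans (un i₀) (trans (cong (a ℕ.+_) (ind-yes (f′ u FinP.≟ i₀) fu)) (ℕP.+-comm a 1))
      ma-at : suc (marked f′ q i₀) ≡ b
      ma-at = trans (trans (ℕP.+-comm 1 _) (cong (marked f′ q i₀ ℕ.+_) (sym (ind-yes (f′ u FinP.≟ i₀) fu)))) (ma i₀)

    tail-term : ∀ u → derangeMatrix f p Fin.zero (Fin.suc u) *
      per (λ v c → derangeMatrix f p (Fin.suc v) (skip (Fin.suc u) c)) ≡ rest * same-colour u
    tail-term u rewrite BoolP.∧-zeroʳ (p Fin.zero) with i₀ FinP.≟ f′ u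
    ... | no  _  = zeros (per (λ v c → derangeMatrix f p (Fin.suc v) (skip (Fin.suc u) c))) rest
                     (if p′ u then D (suc a) (ℕ.pred b) else D a b)
      where
      zeros : ∀ x r y → 0ℤ * 1ℤ * x ≡ r * (0ℤ * y)
      zeros = solve-∀
    ... | yes eq = trans (cong (1ℤ * 1ℤ *_) (minor (Fin.suc u) eq)) (trans (cong (1ℤ * 1ℤ *_) (value (p′ u) refl))
                     (ones _ rest))
      where
      ones : ∀ x r → 1ℤ * 1ℤ * (x * r) ≡ r * (1ℤ * x)
      ones = solve-∀
      value : ∀ q → p′ u ≡ q → ∏ (countD f′ (unmark p (Fin.suc u))) ≡
        (if p′ u then D (suc a) (ℕ.pred b) else D a b) * rest
      value true  e rewrite e = released u e (sym eq)
      value false e rewrite e = unchanged (Fin.suc u) same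
        where
        same : unmark p (Fin.suc u) ≗ p′
        same v with v FinP.≟ u
        ... | yes refl = trans (BoolP.∧-zeroʳ (p′ v)) (sym e)
        ... | no  _    = BoolP.∧-identityʳ (p′ v)

  derangements-by-colour : ∀ {n} (f : Fin n → Fin k) → per (derangeMatrix f (const true)) ≡ ∏ (λ i → D 0 (fibre f i))
  derangements-by-colour {n} f = trans (per-derangeMatrix f (const true))
    (∏-cong (λ i → cong (λ z → D z (fibre f i)) (sumℕ-zeros n)))

-- Derangement numbers and the block formula

fromℚᵘ-homo-* : ∀ p q → fromℚᵘ p ℚ.* fromℚᵘ q ≡ fromℚᵘ (p ℚᵘ.* q)
fromℚᵘ-homo-* p q = ℚP.toℚᵘ-injective (begin
  toℚᵘ (fromℚᵘ p ℚ.* fromℚᵘ q)            ≈⟨ ℚP.toℚᵘ-homo-* (fromℚᵘ p) (fromℚᵘ q) ⟩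
  toℚᵘ (fromℚᵘ p) ℚᵘ.* toℚᵘ (fromℚᵘ q)    ≈⟨ ℚᵘP.*-cong (ℚP.toℚᵘ-fromℚᵘ p) (ℚP.toℚᵘ-fromℚᵘ q) ⟩
  p ℚᵘ.* q                                ≈⟨ ℚP.toℚᵘ-fromℚᵘ (p ℚᵘ.* q) ⟨
  toℚᵘ (fromℚᵘ (p ℚᵘ.* q))                ∎)
  where open ℚᵘP.≃-Reasoning

fromℚᵘ-homo-+ : ∀ p q → fromℚᵘ p ℚ.+ fromℚᵘ q ≡ fromℚᵘ (p ℚᵘ.+ q)
fromℚᵘ-homo-+ p q = ℚP.toℚᵘ-injective (begin
  toℚᵘ (fromℚᵘ p ℚ.+ fromℚᵘ q)            ≈⟨ ℚP.toℚᵘ-homo-+ (fromℚᵘ p) (fromℚᵘ q) ⟩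
  toℚᵘ (fromℚᵘ p) ℚᵘ.+ toℚᵘ (fromℚᵘ q)    ≈⟨ ℚᵘP.+-cong (ℚP.toℚᵘ-fromℚᵘ p) (ℚP.toℚᵘ-fromℚᵘ q) ⟩
  p ℚᵘ.+ q                                ≈⟨ ℚP.toℚᵘ-fromℚᵘ (p ℚᵘ.+ q) ⟨
  toℚᵘ (fromℚᵘ (p ℚᵘ.+ q))                ∎)
  where open ℚᵘP.≃-Reasoning

/1-homo-* : ∀ x y → (x / 1) ℚ.* (y / 1) ≡ (x * y) / 1
/1-homo-* x y = fromℚᵘ-homo-* (mkℚᵘ x 0) (mkℚᵘ y 0)

/1-homo-+ : ∀ x y → (x / 1) ℚ.+ (y / 1) ≡ (x + y) / 1
/1-homo-+ x y = trans (fromℚᵘ-homo-+ (mkℚᵘ x 0) (mkℚᵘ y 0))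
  (cong (_/ 1) (cong₂ _+_ (ℤP.*-identityʳ x) (ℤP.*-identityʳ y)))

/-cancel : ∀ m .{{_ : ℕ.NonZero m}} x → (+ m / 1) ℚ.* (x / m) ≡ x / 1
/-cancel (suc m) x = trans (fromℚᵘ-homo-* (mkℚᵘ (+ suc m) 0) (mkℚᵘ x m))
  (ℚP.fromℚᵘ-cong {mkℚᵘ (+ suc m) 0 ℚᵘ.* mkℚᵘ x m} {mkℚᵘ x 0} (*≡* (trans
    (trans (ℤP.*-identityʳ _) (ℤP.*-comm (+ suc m) x))
    (cong (λ z → x * + suc z) (sym (ℕP.+-identityʳ m))))))

-- By `D-suc` at zero free points, the difference between a derangement number and its index times
-- the preceding number changes sign at each step.
D₀-suc : ∀ b → D 0 (suc b) ≡ + suc b * D 0 b + -1ℤ ℤ.^ suc b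
D₀-suc zero = refl
D₀-suc (suc b) = begin
  D 0 (suc (suc b))
    ≡⟨ D-suc 0 (suc b) ⟩
  0ℤ * D 0 (suc b) + + suc b * D 1 b
    -- `D 0 (suc b)` unfolds to `D 1 b - D 0 b`, so the equation is a polynomial identity in the
    -- latter two.
    ≡⟨ shuffle (+ b) (D 1 b) (D 0 b) ⟩
  + suc (suc b) * D 0 (suc b) + -1ℤ * (D 0 (suc b) - + suc b * D 0 b)
    ≡⟨ cong (λ z → + suc (suc b) * D 0 (suc b) + -1ℤ * (z - + suc b * D 0 b)) (D₀-suc b) ⟩
  + suc (suc b) * D 0 (suc b) + -1ℤ * ((+ suc b * D 0 b + s) - + suc b * D 0 b)
    ≡⟨ cong (λ z → + suc (suc b) * D 0 (suc b) + -1ℤ * z) (cancel (+ suc b * D 0 b) s) ⟩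
  + suc (suc b) * D 0 (suc b) + -1ℤ * s ∎
  where
  open ≡-Reasoning
  s = -1ℤ ℤ.^ suc b
  shuffle : ∀ b x y → 0ℤ * (x - y) + (+ 1 + b) * x ≡
                      (+ 1 + (+ 1 + b)) * (x - y) + -1ℤ * ((x - y) - (+ 1 + b) * y)
  shuffle = solve-∀
  cancel : ∀ x y → (x + y) - x ≡ y
  cancel = solve-∀

Σℚ≡sumℚF : ∀ {m} (g : Fin m → ℚ) → Σℚ g ≡ sumℚF g
Σℚ≡sumℚF g = trans (sym (ListP.foldr-map ℚ._+_ g 0ℚ (allFin _)))
  (trans (cong (foldr ℚ._+_ 0ℚ) (ListP.map-tabulate id g)) (foldr-tabulate ℚ._+_ 0ℚ g))

altTerm : ℕ → ℚ
altTerm j = ((-1ℤ ℤ.^ j) / (j !)) {{j ℕP.!≢0}}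

-- The new factorial turns the last summand into a bare sign and passes a factor `suc b` to the
-- others: the recurrence of `D₀-suc` on the rational side.
derTerm-suc : ∀ b → derTerm (suc b) ≡ (+ suc b / 1) ℚ.* derTerm b ℚ.+ ((-1ℤ ℤ.^ suc b) / 1)
derTerm-suc b = begin
  (+ (suc b !) / 1) ℚ.* Σℚ {suc (suc b)} (altTerm ∘ toℕ)
    ≡⟨ cong ((+ (suc b !) / 1) ℚ.*_) split ⟩
  (+ (suc b !) / 1) ℚ.* (S ℚ.+ altTerm (suc b))
    ≡⟨ ℚP.*-distribˡ-+ (+ (suc b !) / 1) S (altTerm (suc b)) ⟩
  (+ (suc b !) / 1) ℚ.* S ℚ.+ (+ (suc b !) / 1) ℚ.* altTerm (suc b)
    ≡⟨ cong₂ ℚ._+_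
         (trans (cong (ℚ._* S) (trans (cong (_/ 1) (ℤP.pos-* (suc b) (b !))) (sym (/1-homo-* (+ suc b) (+ (b !))))))
                (ℚP.*-assoc (+ suc b / 1) (+ (b !) / 1) S))
         (/-cancel (suc b !) {{suc b ℕP.!≢0}} (-1ℤ ℤ.^ suc b)) ⟩
  (+ suc b / 1) ℚ.* derTerm b ℚ.+ ((-1ℤ ℤ.^ suc b) / 1) ∎
  where
  open ≡-Reasoning
  S : ℚ
  S = Σℚ {suc b} (altTerm ∘ toℕ)
  split : Σℚ {suc (suc b)} (altTerm ∘ toℕ) ≡ S ℚ.+ altTerm (suc b)
  split = begin
    Σℚ {suc (suc b)} (altTerm ∘ toℕ)
      ≡⟨ Σℚ≡sumℚF {suc (suc b)} (altTerm ∘ toℕ) ⟩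
    sumℚF {suc (suc b)} (altTerm ∘ toℕ)
      ≡⟨ sumℚF-init-last {suc b} (altTerm ∘ toℕ) ⟩
    sumℚF {suc b} (λ j → altTerm (toℕ (Fin.inject₁ j))) ℚ.+ altTerm (toℕ (Fin.fromℕ (suc b)))
      ≡⟨ cong₂ ℚ._+_ (sumℚF-cong {suc b} (λ j → cong altTerm (FinP.toℕ-inject₁ j)))
                     (cong altTerm (FinP.toℕ-fromℕ (suc b))) ⟩
    sumℚF {suc b} (altTerm ∘ toℕ) ℚ.+ altTerm (suc b)
      ≡⟨ cong (ℚ._+ altTerm (suc b)) (Σℚ≡sumℚF {suc b} (altTerm ∘ toℕ)) ⟨
    S ℚ.+ altTerm (suc b) ∎

derTerm≡D : ∀ b → derTerm b ≡ D 0 b / 1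
derTerm≡D zero    = refl
derTerm≡D (suc b) = begin
  derTerm (suc b)
    ≡⟨ derTerm-suc b ⟩
  (+ suc b / 1) ℚ.* derTerm b ℚ.+ ((-1ℤ ℤ.^ suc b) / 1)
    ≡⟨ cong (λ z → (+ suc b / 1) ℚ.* z ℚ.+ ((-1ℤ ℤ.^ suc b) / 1)) (derTerm≡D b) ⟩
  (+ suc b / 1) ℚ.* (D 0 b / 1) ℚ.+ ((-1ℤ ℤ.^ suc b) / 1)
    ≡⟨ cong (ℚ._+ ((-1ℤ ℤ.^ suc b) / 1)) (/1-homo-* (+ suc b) (D 0 b)) ⟩
  ((+ suc b * D 0 b) / 1) ℚ.+ ((-1ℤ ℤ.^ suc b) / 1)
    ≡⟨ /1-homo-+ (+ suc b * D 0 b) (-1ℤ ℤ.^ suc b) ⟩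
  (+ suc b * D 0 b + -1ℤ ℤ.^ suc b) / 1
    ≡⟨ cong (_/ 1) (D₀-suc b) ⟨
  D 0 (suc b) / 1 ∎
  where open ≡-Reasoning

Πℚ-derTerm : ∀ {k} (α : Fin k → ℕ) → Πℚ (λ i → derTerm (α i)) ≡ Πℤ (λ i → D 0 (α i)) / 1
Πℚ-derTerm {k} α = go (allFin k)
  where
  go : ∀ xs → foldr (λ i acc → derTerm (α i) ℚ.* acc) 1ℚ xs ≡ foldr (λ i acc → D 0 (α i) * acc) (+ 1) xs / 1
  go List.[]       = refl
  go (x List.∷ xs) = trans (cong₂ ℚ._*_ (derTerm≡D (α x)) (go xs)) (/1-homo-* (D 0 (α x)) _)

sumℚ-/1 : ∀ {A : Set} (g : A → ℚ) (h : A → ℤ) → (∀ x → g x ≡ h x / 1) →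
  ∀ xs → sumℚ (map g xs) ≡ sumℤ (map h xs) / 1
sumℚ-/1 g h e List.[]       = refl
sumℚ-/1 g h e (x List.∷ xs) = trans (cong₂ ℚ._+_ (e x) (sumℚ-/1 g h e xs)) (/1-homo-+ (h x) _)

blockFormula≡∑F : ∀ {n k} (B : Fin k → Subset n) → blockFormula B ≡
  ∑F {k} {suc n} (λ φ → 𝟙 (admissible? B (toℕ ∘ φ)) * ∏ (λ i → D 0 (toℕ (φ i)))) / 1
blockFormula≡∑F {n} {k} B = trans (sumℚ-/1 _ (λ α → Πℤ (λ i → D 0 (α i))) Πℚ-derTerm (filter (admissible? B) αs))
  (cong (_/ 1) (begin
    sumℤ (map (λ α → Πℤ (λ i → D 0 (α i))) (filter (admissible? B) αs))
      ≡⟨ sumℤ-filter (admissible? B) _ αs ⟩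
    sumℤ (map (λ α → 𝟙 (admissible? B α) * Πℤ (λ i → D 0 (α i))) αs)
      ≡⟨ cong sumℤ (ListP.map-∘ (allFuns k (suc n))) ⟨
    sumℤ (map (λ φ → 𝟙 (admissible? B (toℕ ∘ φ)) * Πℤ (λ i → D 0 (toℕ (φ i)))) (allFuns k (suc n)))
      ≡⟨ sumℤ-allFuns k (suc n) _ ⟩
    ∑F {k} {suc n} (λ φ → 𝟙 (admissible? B (toℕ ∘ φ)) * Πℤ (λ i → D 0 (toℕ (φ i))))
      ≡⟨ ∑F-cong (λ φ → cong (𝟙 (admissible? B (toℕ ∘ φ)) *_) (Πℤ≡∏ (λ i → D 0 (toℕ (φ i))))) ⟩
    ∑F {k} {suc n} (λ φ → 𝟙 (admissible? B (toℕ ∘ φ)) * ∏ (λ i → D 0 (toℕ (φ i)))) ∎))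
  where
  open ≡-Reasoning
  αs : List (Fin k → ℕ)
  αs = map (λ f i → toℕ (f i)) (allFuns k (suc n))

fibre≤n : ∀ {n k} (f : Fin n → Fin k) i → fibre f i ℕ.≤ n
fibre≤n {n} f i = ℕP.≤-trans (sum-mono (λ v → ind≤1 (f v FinP.≟ i))) (ℕP.≤-reflexive (sum-one n))
  where
  ind≤1 : ∀ {P : Set} (d : Dec P) → ind d ℕ.≤ 1
  ind≤1 d = ind-mono d (yes refl) (λ _ → refl {x = 0})

fibre-cong : ∀ {n k} {f g : Fin n → Fin k} → f ≗ g → fibre f ≗ fibre g
fibre-cong e i = sumℕ-cong (λ v → cong (λ z → ind (z FinP.≟ i)) (e v))

Admissible-resp : ∀ {n k} (B : Fin k → Subset n) {α β : Fin k → ℕ} → α ≗ β → Admissible B α → Admissible B β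
Admissible-resp B {α} {β} e (total , hall) =
  trans (sym (trans (Σℕ≡sum α) (trans (sumℕ-cong e) (sym (Σℕ≡sum β))))) total ,
  λ S ne → ℕP.≤-trans (ℕP.≤-reflexive (sym (trans (ΣOver≡sum S α)
    (trans (sumℕ-cong (λ i → cong (ind (i SubP.∈? S) ℕ.*_) (e i))) (sym (ΣOver≡sum S β)))))) (hall S ne)

-- The permanent as a sum over assignments and over sizes

module Assembly {n} (G : SignedGraph n) (clique : IsBlockGraph G) (pos : AllEdgesPositive G)
                {k} (B : Fin k → Subset n) (blocks : AreTheBlocks G B) where
  open Blocks G B blocks
  open BlockAssignments G B blocks

  valid? : ∀ f → Dec (Valid B f)
  valid? f = FinP.all? (λ v → v SubP.∈? B (f v))

  Valid-resp : ∀ {f g} → f ≗ g → Valid B f → Valid B g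
  Valid-resp e val v = subst (λ z → v ∈ B z) (e v) (val v)

  Deranges : (Fin n → Fin n) → (Fin n → Fin k) → Fin n → Set
  Deranges σ f v = f v ≡ f (σ v) × v ≢ σ v

  deranges? : ∀ σ f v → Dec (Deranges σ f v)
  deranges? σ f v = (f v FinP.≟ f (σ v)) ×-dec ¬? (v FinP.≟ σ v)

  compatible? : ∀ σ f → Dec (Valid B f × (∀ v → Deranges σ f v))
  compatible? σ f = valid? f ×-dec FinP.all? (deranges? σ f)

  ∏-derangeMatrix : ∀ σ f → 𝟙 (valid? f) * ∏ (λ v → derangeMatrix f (const true) v (σ v)) ≡ 𝟙 (compatible? σ f)
  ∏-derangeMatrix σ f = trans (cong (𝟙 (valid? f) *_) (trans (∏-cong entry) (∏-𝟙 (deranges? σ f)))) 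
    (𝟙-× (valid? f) (FinP.all? (deranges? σ f)))
    where
    entry : ∀ v → derangeMatrix f (const true) v (σ v) ≡ 𝟙 (deranges? σ f v)
    entry v = trans (cong (𝟙 (f v FinP.≟ f (σ v)) *_) (complement (v FinP.≟ σ v)))
                    (𝟙-× (f v FinP.≟ f (σ v)) (¬? (v FinP.≟ σ v)))
      where
      complement : ∀ {P : Set} (d : Dec P) → (if does d then 0ℤ else 1ℤ) ≡ 𝟙 (¬? d)
      complement (yes _) = refl
      complement (no _)  = refl

  compatible-adjacent : ∀ σ f → Valid B f × (∀ v → Deranges σ f v) → ∀ v → Adj G v (σ v)
  compatible-adjacent σ f (val , der) v = let e , v≢ = der v in
    clique (B (f v)) (isBlock (f v)) v (σ v) (val v) (subst (λ z → σ v ∈ B z) (sym e) (val (σ v))) v≢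

  compatible-resp : ∀ σ {f g} → f ≗ g → Valid B f × (∀ v → Deranges σ f v) → Valid B g × (∀ v → Deranges σ g v)
  compatible-resp σ e (val , der) = Valid-resp e val , λ v →
    trans (sym (e v)) (trans (proj₁ (der v)) (e (σ v))) , proj₂ (der v)

  -- A compatible assignment puts `v` and `σ v` in a common block, which is a clique; so a non-edge
  -- makes both sides zero. If all pairs are edges, the product is 1, and the blocks of these edges
  -- form the only compatible assignment: they are constant along cycles, and two distinct vertices
  -- share at most one block.
  ∑F-compatible : ∀ σ → IsInjective σ → ∏ (λ v → w G v (σ v)) ≡ ∑F (λ f → 𝟙 (compatible? σ f))
  ∑F-compatible σ inj with FinP.all? (λ v → ¬? (w G v (σ v) ℤP.≟ + 0))
  ... | no ¬adj = let v , ¬¬e = FinP.¬∀⟶∃¬ n (λ v → Adj G v (σ v)) (λ v → ¬? (w G v (σ v) ℤP.≟ + 0)) ¬adj in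
    trans (∏-zero (λ v → w G v (σ v)) v (decidable-stable (w G v (σ v) ℤP.≟ + 0) ¬¬e))
      (sym (∑F-zero (λ f → 𝟙-no (compatible? σ f) (¬adj ∘ compatible-adjacent σ f))))
  ... | yes adj = trans (∏-one (λ v → w G v (σ v)) (λ v → pos v (σ v) (adj v)))
      (sym (trans (∑F-single (λ f → 𝟙 (compatible? σ f))
        (λ {f} {g} e → 𝟙-cong (compatible? σ f) (compatible? σ g) (compatible-resp σ e) (compatible-resp σ (sym ∘ e)))
        f₀ (λ f ne → 𝟙-no (compatible? σ f) (ne ∘ unique f)))
        (𝟙-yes (compatible? σ f₀) compatible₀)))
    where
    f₀ : Fin n → Fin k
    f₀ v = proj₁ (edge-in-block (adj v))
    on₀ : ∀ v → v ∈ B (f₀ v) × σ v ∈ B (f₀ v) × v ≢ σ v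
    on₀ v = let _ , v∈ , σv∈ = edge-in-block (adj v) in v∈ , σv∈ , Adj-irrefl G (adj v)
    compatible₀ : Valid B f₀ × (∀ v → Deranges σ f₀ v)
    compatible₀ = (proj₁ ∘ on₀) , λ v → sym (injective-blocks-constant σ inj f₀ on₀ v) , proj₂ (proj₂ (on₀ v))
    unique : ∀ f → Valid B f × (∀ v → Deranges σ f v) → f ≗ f₀
    unique f (val , der) v = two-points-one-block (proj₂ (der v)) (val v)
      (subst (λ z → σ v ∈ B z) (sym (proj₁ (der v))) (val (σ v))) (proj₁ (on₀ v)) (proj₁ (proj₂ (on₀ v)))

  per≡∑F-assignments : per (adjMatrix G) ≡ ∑F (λ f → 𝟙 (valid? f) * ∏ (λ i → D 0 (fibre f i)))
  per≡∑F-assignments = begin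
    per (w G)
      ≡⟨ per≡∑F (w G) ⟩
    ∑F (λ σ → 𝟙 (isInjective? σ) * ∏ (λ v → w G v (σ v)))
      ≡⟨ ∑F-cong by-assignment ⟩
    ∑F (λ σ → ∑F (λ f → 𝟙 (valid? f) * perTerm (derangeMatrix f (const true)) σ))
      ≡⟨ ∑F-comm (λ σ f → 𝟙 (valid? f) * perTerm (derangeMatrix f (const true)) σ) ⟩
    ∑F (λ f → ∑F (λ σ → 𝟙 (valid? f) * perTerm (derangeMatrix f (const true)) σ))
      ≡⟨ ∑F-cong (λ f → trans (sym (*-∑F (𝟙 (valid? f)) (perTerm (derangeMatrix f (const true)))))
           (cong (𝟙 (valid? f) *_)
           (trans (sym (per≡∑F (derangeMatrix f (const true)))) (derangements-by-colour f)))) ⟩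
    ∑F (λ f → 𝟙 (valid? f) * ∏ (λ i → D 0 (fibre f i))) ∎
    where
    open ≡-Reasoning
    by-assignment : ∀ σ → 𝟙 (isInjective? σ) * ∏ (λ v → w G v (σ v)) ≡
      ∑F (λ f → 𝟙 (valid? f) * perTerm (derangeMatrix f (const true)) σ)
    by-assignment σ = trans (on-injective (isInjective? σ)) (trans
      (*-∑F (𝟙 (isInjective? σ)) (λ f → 𝟙 (compatible? σ f)))
      (∑F-cong (λ f → trans (cong (𝟙 (isInjective? σ) *_) (sym (∏-derangeMatrix σ f)))
                            (x*[y*z]≡y*[x*z] (𝟙 (isInjective? σ)) (𝟙 (valid? f)) _))))
      where
      -- The product counts the compatible assignments only for injective `σ`; for all others the
      -- indicator kills both sides.
      on-injective : ∀ d → 𝟙 {IsInjective σ} d * ∏ (λ v → w G v (σ v)) ≡ 𝟙 d * ∑F (λ f → 𝟙 (compatible? σ f))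
      on-injective (yes inj) = cong (1ℤ *_) (∑F-compatible σ inj)
      on-injective (no _)    = trans (ℤP.*-zeroˡ (∏ (λ v → w G v (σ v))))
        (sym (ℤP.*-zeroˡ (∑F (λ f → 𝟙 (compatible? σ f)))))

  weight : (Fin k → Fin (suc n)) → ℤ
  weight φ = ∏ (λ i → D 0 (toℕ (φ i)))

  sizes? : ∀ (f : Fin n → Fin k) (φ : Fin k → Fin (suc n)) → Dec (∀ i → toℕ (φ i) ≡ fibre f i)
  sizes? f φ = FinP.all? (λ i → toℕ (φ i) ℕP.≟ fibre f i)

  -- Introduces the tuple of sizes as a summation variable, so that the sums over assignments and
  -- over tuples can be exchanged. The range `Fin (suc n)` suffices because no fibre exceeds `n`.
  ∑F-sizes : ∀ (f : Fin n → Fin k) → ∏ (λ i → D 0 (fibre f i)) ≡ ∑F (λ φ → 𝟙 (sizes? f φ) * weight φ)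
  ∑F-sizes f = sym (begin
    ∑F (λ φ → 𝟙 (sizes? f φ) * weight φ)
      ≡⟨ ∑F-single (λ φ → 𝟙 (sizes? f φ) * weight φ)
           (λ {φ} {ψ} e → cong₂ _*_
             (𝟙-cong (sizes? f φ) (sizes? f ψ) (λ p i → trans (cong toℕ (sym (e i))) (p i))
               (λ p i → trans (cong toℕ (e i)) (p i)))
             (∏-cong (λ i → cong (D 0 ∘ toℕ) (e i))))
           φ₀ (λ φ ne → x≡0⇒x*y≡0 (weight φ) (𝟙-no (sizes? f φ)
             (λ p → ne (λ i → FinP.toℕ-injective (trans (p i) (sym (φ₀≡ i))))))) ⟩
    𝟙 (sizes? f φ₀) * weight φ₀
      ≡⟨ cong₂ _*_ (𝟙-yes (sizes? f φ₀) φ₀≡) (∏-cong (λ i → cong (D 0) (φ₀≡ i))) ⟩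
    1ℤ * ∏ (λ i → D 0 (fibre f i))
      ≡⟨ ℤP.*-identityˡ _ ⟩
    ∏ (λ i → D 0 (fibre f i)) ∎)
    where
    open ≡-Reasoning
    φ₀ : Fin k → Fin (suc n)
    φ₀ i = fromℕ< (s≤s (fibre≤n f i))
    φ₀≡ : ∀ i → toℕ (φ₀ i) ≡ fibre f i
    φ₀≡ i = FinP.toℕ-fromℕ< (s≤s (fibre≤n f i))

  -- An admissible tuple has exactly one assignment: augmentation yields one, and `fibre-determines`
  -- excludes a second. Fibre sizes of valid assignments are always admissible, so any other tuple
  -- has none.
  ∑F-admissible : ∀ φ (d : Dec (Admissible B (toℕ ∘ φ))) → ∑F (λ f → 𝟙 (valid? f ×-dec sizes? f φ)) ≡ 𝟙 d
  ∑F-admissible φ (no ¬adm) = ∑F-zero (λ f → 𝟙-no (valid? f ×-dec sizes? f φ)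
                    (λ (val , sz) → ¬adm (Admissible-resp B (sym ∘ sz) (fibre-admissible B f val))))
  ∑F-admissible φ (yes adm) =
    let f₀ , val₀ , sz₀ = realise-admissible (toℕ ∘ φ) adm
        resp : ∀ {f g} → f ≗ g → Valid B f × (∀ i → toℕ (φ i) ≡ fibre f i) → Valid B g × (∀ i → toℕ (φ i) ≡ fibre g i)
        resp = λ e (val , sz) → Valid-resp e val , λ i → trans (sz i) (fibre-cong e i)
    in trans (∑F-single (λ f → 𝟙 (valid? f ×-dec sizes? f φ))
         (λ {f} {g} e → 𝟙-cong (valid? f ×-dec sizes? f φ) (valid? g ×-dec sizes? g φ) (resp e) (resp (sym ∘ e)))
         f₀ (λ f ne → 𝟙-no (valid? f ×-dec sizes? f φ)
           (λ (val , sz) → ne (fibre-determines f f₀ val val₀ (λ i → trans (sym (sz i)) (sym (sz₀ i)))))))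
       (𝟙-yes (valid? f₀ ×-dec sizes? f₀ φ) (val₀ , sym ∘ sz₀))

  per≡∑F-admissible : per (adjMatrix G) ≡ ∑F (λ φ → 𝟙 (admissible? B (toℕ ∘ φ)) * weight φ)
  per≡∑F-admissible = begin
    per (adjMatrix G)
      ≡⟨ per≡∑F-assignments ⟩
    ∑F (λ f → 𝟙 (valid? f) * ∏ (λ i → D 0 (fibre f i)))
      ≡⟨ ∑F-cong (λ f → trans (cong (𝟙 (valid? f) *_) (∑F-sizes f))
           (trans (*-∑F (𝟙 (valid? f)) (λ φ → 𝟙 (sizes? f φ) * weight φ)) (∑F-cong (regroup f)))) ⟩
    ∑F (λ f → ∑F (λ φ → weight φ * 𝟙 (valid? f ×-dec sizes? f φ)))
      ≡⟨ ∑F-comm (λ f φ → weight φ * 𝟙 (valid? f ×-dec sizes? f φ)) ⟩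
    ∑F (λ φ → ∑F (λ f → weight φ * 𝟙 (valid? f ×-dec sizes? f φ)))
      ≡⟨ ∑F-cong (λ φ → trans (sym (*-∑F (weight φ) (λ f → 𝟙 (valid? f ×-dec sizes? f φ))))
           (trans (cong (weight φ *_) (∑F-admissible φ (admissible? B (toℕ ∘ φ))))
             (ℤP.*-comm (weight φ) (𝟙 (admissible? B (toℕ ∘ φ)))))) ⟩
    ∑F (λ φ → 𝟙 (admissible? B (toℕ ∘ φ)) * weight φ) ∎
    where
    open ≡-Reasoning
    rotate : ∀ x y z → x * (y * z) ≡ z * (x * y)
    rotate = solve-∀
    regroup : ∀ f φ → 𝟙 (valid? f) * (𝟙 (sizes? f φ) * weight φ) ≡ weight φ * 𝟙 (valid? f ×-dec sizes? f φ)
    regroup f φ = trans (rotate (𝟙 (valid? f)) (𝟙 (sizes? f φ)) (weight φ))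
      (cong (weight φ *_) (𝟙-× (valid? f) (sizes? f φ)))

theorem6 : (n : ℕ) (G : SignedGraph n) → Balanced G → IsBlockGraph G →
    AllEdgesPositive G → (k : ℕ) (B : Fin k → Subset n) →
    AreTheBlocks G B →
    (per (adjMatrix G) / 1) ≡ blockFormula B
theorem6 n G _ clique pos k B blocks =
  trans (cong (_/ 1) (Assembly.per≡∑F-admissible G clique pos B blocks)) (sym (blockFormula≡∑F B))
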